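{- Let $\Gamma$ be a Shilla distance-regular graph with $b(\Gamma)=b\geq 2$ and with eigenvalue multiplicities satisfying $m_2=m_3$. Then: (i) $a_3-b<b_2+c_2<a_3+b$; (ii) $c_2<b_2+b$; (iii) if $b_2+c_2=a_3$ or $b_2=c_2$, then $a_3=\frac{b(b-1)}{2}$.
   Context: A connected graph $\Gamma$ of diameter $D$ is distance-regular if there are integers $b_i,c_i$ ($0\le i\le D$) such that for any two vertices $x,y$ at distance $i$, exactly $c_i$ neighbours of $y$ are at distance $i-1$ from $x$ and exactly $b_i$ neighbours of $y$ are at distance $i+1$ from $x$. Then $\Gamma$ is regular of valency $k=b_0$, and $a_i:=k-b_i-c_i$. The eigenvalues of $\Gamma$ are those of its adjacency matrix; $\Gamma$ has exactly $D+1$ distinct eigenvalues $k=\theta_0>\theta_1>\dots>\theta_D$, and $m_i$ denotes the multiplicity of $\theta_i$. A Shilla distance-regular graph is a distance-regular graph of diameter $3$ whose second largest eigenvalue satisfies $\theta_1=a_3$. For such graphs $k=(a_3-a_1)a_3$, and one defines $b(\Gamma):=a_3-a_1=k/a_3$. -}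

module Defs where

open import Level using (Level; 0ℓ; _⊔_) renaming (suc to lsuc)
open import Algebra.Apartness.Bundles using (HeytingField; HeytingCommutativeRing)
open import Algebra.Bundles using (CommutativeRing)
import Algebra.Properties.Semiring.Mult as SemiringMult
import Algebra.Properties.Semiring.Sum as SemiringSum
open import Data.Bool.Base using (if_then_else_)
open import Data.Fin.Base as Fin using (Fin; zero; suc; toℕ)
open import Data.Fin.Patterns using (1F; 3F)
open import Data.Fin.Subset using (Subset; _∈_; ∣_∣)
open import Data.Integer.Base as ℤ using (ℤ; +_; -[1+_])
open import Data.Nat.Base as ℕ using (ℕ; zero; suc)
open import Data.Product.Base using (Σ-syntax; ∃; ∃-syntax; _×_)
open import Data.Sum.Base using (_⊎_)
open import Data.Vec.Functional using (Vector)
open import Function.Bundles using (_⇔_)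
open import Relation.Binary.Core using (Rel)
open import Relation.Binary.Definitions using (Decidable; Irreflexive; Symmetric)
open import Relation.Binary.PropositionalEquality.Core using (_≡_)
open import Relation.Binary.Structures using (IsStrictPartialOrder)
open import Relation.Nullary.Decidable.Core using (does)
open import Relation.Unary using (Pred)

-- The real numbers, axiomatised as a Cauchy-complete Archimedean ordered
-- field; these axioms determine ℝ up to isomorphism.  The underlying field is
-- a Heyting field, so that the order need not be decidable and the
-- constructive reals are a model as well as the classical ones.

record RealField c ℓ₁ ℓ₂ ℓ₃ : Set (lsuc (c ⊔ ℓ₁ ⊔ ℓ₂ ⊔ ℓ₃)) where
  infix 4 _<_
  field
    heytingField : HeytingField c ℓ₁ ℓ₂

  open HeytingField heytingField public
  open CommutativeRing
    (HeytingCommutativeRing.commutativeRing heytingCommutativeRing) public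
    using (semiring)
  open SemiringMult semiring public using () renaming (_×_ to _×#_)

  field
    _<_                  : Rel Carrier ℓ₃
    isStrictPartialOrder : IsStrictPartialOrder _≈_ _<_
    #⇔<⊎>                : ∀ {x y} → (x # y) ⇔ (x < y ⊎ y < x)
    +-monoˡ-<            : ∀ {x y} z → x < y → x + z < y + z
    *-pos                : ∀ {x y} → 0# < x → 0# < y → 0# < x * y
    archimedean          : ∀ x → ∃[ n ] x < n ×# 1#

  -- ∣ x - y ∣ < 1 / (k + 1)
  Within : ℕ → Carrier → Carrier → Set ℓ₃
  Within k x y = (suc k ×# (x - y) < 1#) × (suc k ×# (y - x) < 1#)

  IsCauchy : (ℕ → Carrier) → Set ℓ₃
  IsCauchy s = ∀ k → ∃[ N ] (∀ i j → N ℕ.≤ i → N ℕ.≤ j → Within k (s i) (s j))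

  _ConvergesTo_ : (ℕ → Carrier) → Carrier → Set ℓ₃
  s ConvergesTo x = ∀ k → ∃[ N ] (∀ i → N ℕ.≤ i → Within k (s i) x)

  field
    complete : ∀ s → IsCauchy s → ∃[ x ] (s ConvergesTo x)

  fromℤ : ℤ → Carrier
  fromℤ (+ n)    = n ×# 1#
  fromℤ -[1+ n ] = - (suc n ×# 1#)

record Graph (n : ℕ) : Set₁ where
  infix 4 _∼_ _∼?_
  field
    _∼_    : Rel (Fin n) 0ℓ
    _∼?_   : Decidable _∼_
    sym    : Symmetric _∼_
    irrefl : Irreflexive _≡_ _∼_

HasCardinality : ∀ {n} → Pred (Fin n) 0ℓ → ℕ → Set
HasCardinality {n} P k =
  Σ[ S ∈ Subset n ] (∀ z → (z ∈ S) ⇔ P z) × (∣ S ∣ ≡ k)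

module _ {n : ℕ} (Γ : Graph n) where
  open Graph Γ

  data Walk : Fin n → Fin n → ℕ → Set where
    []  : ∀ {x} → Walk x x 0
    _∷_ : ∀ {x y z ℓ} → x ∼ y → Walk y z ℓ → Walk x z (suc ℓ)

  Distance : Fin n → Fin n → ℕ → Set
  Distance x y d = Walk x y d × (∀ {ℓ} → Walk x y ℓ → d ℕ.≤ ℓ)

  Connected : Set
  Connected = ∀ x y → ∃[ ℓ ] Walk x y ℓ

  HasDiameter : ℕ → Set
  HasDiameter D =
      (∀ {x y d} → Distance x y d → d ℕ.≤ D)
    × (∃[ x ] ∃[ y ] Distance x y D)

  record IsDistanceRegular (D : ℕ) (b c : Fin (suc D) → ℕ) : Set where
    field
      connected : Connected
      diameter  : HasDiameter D
      -- "at distance i - 1" is spelled without subtraction, so that for i = 0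
      -- the set is empty.
      c-count   : ∀ i {x y} → Distance x y (toℕ i) →
                  HasCardinality
                    (λ z → y ∼ z × ∃[ j ] (suc j ≡ toℕ i × Distance x z j))
                    (c i)
      b-count   : ∀ i {x y} → Distance x y (toℕ i) →
                  HasCardinality
                    (λ z → y ∼ z × Distance x z (suc (toℕ i)))
                    (b i)

record DistanceRegularGraph (D : ℕ) : Set₁ where
  field
    order             : ℕ
    graph             : Graph order
    b[_] c[_]         : Fin (suc D) → ℕ
    isDistanceRegular : IsDistanceRegular graph D b[_] c[_]

  valency : ℕ
  valency = b[ zero ]

  a[_] : Fin (suc D) → ℤ
  a[ i ] = + valency ℤ.- + b[ i ] ℤ.- + c[ i ]

module Spectral {c ℓ₁ ℓ₂ ℓ₃} (ℝ : RealField c ℓ₁ ℓ₂ ℓ₃) where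
  open RealField ℝ
  open SemiringSum semiring using (sum-syntax)

  Matrix : ℕ → Set c
  Matrix n = Fin n → Fin n → Carrier

  adjacencyMatrix : ∀ {n} → Graph n → Matrix n
  adjacencyMatrix Γ x y = if does (Graph._∼?_ Γ x y) then 1# else 0#

  infixr 7 _*ᵥ_
  _*ᵥ_ : ∀ {n} → Matrix n → Vector Carrier n → Vector Carrier n
  _*ᵥ_ {n} M v x = ∑[ y < n ] (M x y * v y)

  combination : ∀ {n m} → Vector Carrier m → Vector (Vector Carrier n) m →
                Vector Carrier n
  combination {m = m} t B x = ∑[ j < m ] (t j * B j x)

  LinearlyIndependent : ∀ {n m} → Vector (Vector Carrier n) m → Set (c ⊔ ℓ₁)
  LinearlyIndependent B =
    ∀ t → (∀ x → combination t B x ≈ 0#) → ∀ j → t j ≈ 0#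

  record IsBasis {ℓ} {n m} (V : Pred (Vector Carrier n) ℓ)
                 (B : Vector (Vector Carrier n) m) : Set (c ⊔ ℓ₁ ⊔ ℓ) where
    field
      member      : ∀ j → V (B j)
      independent : LinearlyIndependent B
      spanning    : ∀ v → V v → ∃[ t ] (∀ x → v x ≈ combination t B x)

  HasDimension : ∀ {ℓ n} → Pred (Vector Carrier n) ℓ → ℕ → Set (c ⊔ ℓ₁ ⊔ ℓ)
  HasDimension {n = n} V m =
    Σ[ B ∈ Vector (Vector Carrier n) m ] IsBasis V B

  Eigenspace : ∀ {n} → Matrix n → Carrier → Pred (Vector Carrier n) ℓ₁
  Eigenspace M μ v = ∀ x → (M *ᵥ v) x ≈ μ * v x

  IsEigenvalue : ∀ {n} → Matrix n → Carrier → Set (c ⊔ ℓ₁ ⊔ ℓ₂)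
  IsEigenvalue M μ = ∃[ v ] (Eigenspace M μ v × ∃[ x ] (v x # 0#))

  -- θ lists the distinct eigenvalues in decreasing order, and m their
  -- multiplicities.
  record IsSpectrum {n r} (Γ : Graph n) (θ : Fin r → Carrier) (m : Fin r → ℕ)
                    : Set (c ⊔ ℓ₁ ⊔ ℓ₂ ⊔ ℓ₃) where
    field
      decreasing   : ∀ {i j} → i Fin.< j → θ j < θ i
      eigenvalue   : ∀ i → IsEigenvalue (adjacencyMatrix Γ) (θ i)
      exhaustive   : ∀ μ → IsEigenvalue (adjacencyMatrix Γ) μ → ∃[ i ] (μ ≈ θ i)
      multiplicity : ∀ i → HasDimension (Eigenspace (adjacencyMatrix Γ) (θ i)) (m i)

  record IsShilla (Γ : DistanceRegularGraph 3)
                  (θ : Fin 4 → Carrier) (m : Fin 4 → ℕ)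
                  : Set (c ⊔ ℓ₁ ⊔ ℓ₂ ⊔ ℓ₃) where
    open DistanceRegularGraph Γ
    field
      isSpectrum : IsSpectrum graph θ m
      θ₁≈a₃      : θ 1F ≈ fromℤ a[ 3F ]

shillaParameter : DistanceRegularGraph 3 → ℤ
shillaParameter Γ = a[ 3F ] ℤ.- a[ 1F ]
  where open DistanceRegularGraph Γ

-- Write s = a₃ and e = b₂ + c₂.  An eigenvector for the eigenvalue a₃ forces
-- k = b s, hence b₁ = (b - 1) (s + 1) and c₃ = (b - 1) s, and then θ₂ and θ₃ are
-- the roots of X² - t X + q with t = s - b - e and q = b b₂ + c₂ - b s.  Since
-- tr ∏ (A - θⱼ) = mᵢ ∏ (θᵢ - θⱼ), with j ranging over the indices other than i,
-- the multiplicities satisfy tr Aʲ = ∑ mᵢ θᵢʲ; for j = 0, 1, 2 and m₂ = m₃ = m,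
--   n = 1 + m₁ + 2 m,   0 = k + m₁ s + m t,   n k = k² + m₁ s² + m (t² - 2 q).
-- The second equation forces t < 0, and t ≤ - 2 b contradicts the three
-- equations; this is (i).  Given (i), (ii) follows from p³₃₃ ≥ 0, which reads
-- c₂ (s + 1) ≤ b₂ (s + b).  Finally, n c₂ = k² - t k + q, and eliminating m₁, m
-- and n leaves
--   (2 b b₂ + 2 c₂ - e (e + b - s)) (e + (b - 1) s) = (b - 1) c₂ (s + e + b),
-- which for e = s, and for b₂ = c₂ given s ≥ b, only allows 2 s = b (b - 1).

module Submission where

open import Defs
import Algebra.Apartness.Properties.HeytingCommutativeRing as HeytingProperties
open import Algebra.Apartness.Bundles using (HeytingCommutativeRing)
open import Algebra.Bundles using (CommutativeRing)
import Algebra.Properties.Ring as RingProperties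
import Algebra.Properties.Semiring.Exp as SemiringExp
import Algebra.Properties.Semiring.Mult as SemiringMult
import Algebra.Properties.Semiring.Sum as SemiringSum
import Algebra.Solver.Ring as RingSolver
open import Algebra.Solver.Ring.AlmostCommutativeRing
  using (fromCommutativeRing; _-Raw-AlmostCommutative⟶_)
open import Data.Bool.Base using (true; false; if_then_else_)
open import Data.Fin.Base using (Fin; zero; suc; toℕ)
open import Data.Fin.Patterns using (0F; 1F; 2F; 3F)
import Data.Fin.Properties as Fin
open import Data.Fin.Subset using (Subset; _∈_; _∉_; ∣_∣; ⁅_⁆)
import Data.Fin.Subset.Properties as Subset
open import Data.Integer.Base as ℤ using (ℤ; +_; -[1+_]; 0ℤ; 1ℤ; +<+; +≤+)
import Data.Integer.Properties as ℤ
open import Data.Integer.Tactic.RingSolver using (solve-∀)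
open import Data.List.Base using (List; []; _∷_; foldr; _++_)
open import Data.Maybe.Base using (Maybe; nothing; just)
open import Data.Nat.Base as ℕ using (ℕ; zero; suc; z≤n; s≤s)
import Data.Nat.Properties as ℕ
open import Data.Product.Base using (∃-syntax; _×_; _,_; proj₁; proj₂)
open import Data.Rational.Base using (_/_)
import Data.Rational.Properties as ℚ
open import Data.Rational.Unnormalised.Base using (mkℚᵘ; *≡*)
open import Data.Sum.Base using (_⊎_; inj₁; inj₂; [_,_])
open import Data.Vec.Base using ([]; _∷_; here; there; lookup)
open import Data.Vec.Functional using (Vector)
open import Function.Bundles using (_⇔_; mk⇔; module Equivalence)
open import Relation.Binary.Definitions using (tri<; tri≈; tri>)
open import Relation.Binary.PropositionalEquality as ≡ using (_≡_; _≢_)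
import Relation.Binary.Reasoning.Setoid as SetoidReasoning
open import Relation.Binary.Structures using (IsStrictPartialOrder)
open import Relation.Nullary.Decidable
  using (Dec; yes; no; does; map′; _×-dec_; dec-true; dec-false)
open import Relation.Nullary.Negation using (¬_; contradiction)

-- The field may be constructive, so zero cannot be tested and an eigenspace comes with nothing but
-- a basis. Cancellation in the field therefore rests on apartness: of two eigenvalues, of a
-- positive count from zero, of an eigenvector entry from zero. Comparisons that need a decision are
-- made in ℤ: equations are brought to a form whose two sides are values of `fromℤ`, which is
-- injective. The eigenvalues θ₂ and θ₃ need not be integers, but as m₂ = m₃ they enter only through
-- their sum t and product q, which are. The source of the trace identities is (A - s)(A - θ₂)(A -
-- θ₃) = c₂ c₃ J, with J the all-ones matrix; this is Hoffman's polynomial up to scaling. One more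
-- factor A - k annihilates it. Applied to the all-ones vector it determines n, and its trace shows
-- that k is a simple eigenvalue, which the hypotheses do not state.

-- Signs of integers

i<j⇒0<j-i : ∀ {i j} → i ℤ.< j → 0ℤ ℤ.< j ℤ.- i
i<j⇒0<j-i {i} {j} i<j = ≡.subst (ℤ._< j ℤ.- i) (ℤ.+-inverseʳ i) (ℤ.+-monoˡ-< (ℤ.- i) i<j)

0<i*j : ∀ {i j} → 0ℤ ℤ.< i → 0ℤ ℤ.< j → 0ℤ ℤ.< i ℤ.* j
0<i*j (+<+ (s≤s z≤n)) (+<+ (s≤s z≤n)) = +<+ (s≤s z≤n)

0≤i*j : ∀ {i j} → 0ℤ ℤ.≤ i → 0ℤ ℤ.≤ j → 0ℤ ℤ.≤ i ℤ.* j
0≤i*j {+ m} {+ n} _ _ = ≡.subst (0ℤ ℤ.≤_) (ℤ.pos-* m n) (+≤+ z≤n)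

0≤i+j : ∀ {i j} → 0ℤ ℤ.≤ i → 0ℤ ℤ.≤ j → 0ℤ ℤ.≤ i ℤ.+ j
0≤i+j = ℤ.+-mono-≤

0<i⇒0≤i-1 : ∀ {i} → 0ℤ ℤ.< i → 0ℤ ℤ.≤ i ℤ.- 1ℤ
0<i⇒0≤i-1 (+<+ (s≤s z≤n)) = +≤+ z≤n

0≤i⇒0<i+1 : ∀ {i} → 0ℤ ℤ.≤ i → 0ℤ ℤ.< i ℤ.+ 1ℤ
0≤i⇒0<i+1 0≤i = ℤ.+-mono-≤-< 0≤i (+<+ (s≤s z≤n))

-- The shape in which the bounds and the excluded cases of the integer part are refuted: an identity
-- writes something that vanishes as a positive term plus nonnegative ones.
positive+nonneg≢0 : ∀ {i j} → 0ℤ ℤ.< i → 0ℤ ℤ.≤ j → i ℤ.+ j ≢ 0ℤ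
positive+nonneg≢0 0<i 0≤j i+j≡0 = ℤ.<-irrefl (≡.sym i+j≡0) (ℤ.+-mono-<-≤ 0<i 0≤j)

positive-cancel-0 : ∀ i {j} → 0ℤ ℤ.< i → i ℤ.* j ≡ 0ℤ → j ≡ 0ℤ
positive-cancel-0 i 0<i ij≡0 with ℤ.i*j≡0⇒i≡0∨j≡0 i ij≡0
... | inj₁ i≡0 = contradiction 0<i (ℤ.<-irrefl (≡.sym i≡0))
... | inj₂ j≡0 = j≡0

positive-factor : ∀ {i j} → 0ℤ ℤ.< i → 0ℤ ℤ.< i ℤ.* j → 0ℤ ℤ.< j
positive-factor {i} {j} 0<i 0<ij with ℤ.<-cmp 0ℤ j
... | tri< 0<j _ _ = 0<j
... | tri≈ _ ≡.refl _ = contradiction 0<ij (ℤ.<-irrefl (≡.sym (ℤ.*-zeroʳ i)))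
... | tri> _ _ j<0 = contradiction (identity i j) (positive+nonneg≢0 0<ij (ℤ.<⇒≤ (0<i*j 0<i (ℤ.neg-mono-< j<0))))
  where
  identity : ∀ i j → i ℤ.* j ℤ.+ i ℤ.* (ℤ.- j) ≡ 0ℤ
  identity = solve-∀

-- Walks and distances in a graph

module Walks {n} (Γ : Graph n) where
  open Graph Γ

  _◅◅_ : ∀ {x y z ℓ ℓ′} → Walk Γ x y ℓ → Walk Γ y z ℓ′ → Walk Γ x z (ℓ ℕ.+ ℓ′)
  []      ◅◅ w = w
  (e ∷ v) ◅◅ w = e ∷ (v ◅◅ w)

  walk? : ∀ ℓ x y → Dec (Walk Γ x y ℓ)
  walk? zero    x y = map′ (λ { ≡.refl → [] }) (λ { [] → ≡.refl }) (x Fin.≟ y)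
  walk? (suc ℓ) x y = map′ (λ (_ , e , w) → e ∷ w) (λ { (e ∷ w) → _ , e , w })
    (Fin.any? λ z → (x ∼? z) ×-dec walk? ℓ z y)

  -- Linear search, possible because `walk?` decides each length: `k` grows as long as no walk of
  -- length `k` exists, and the given walk of length `k + fuel` ends the search at the latest when
  -- the fuel is used up.
  shortest : ∀ {x y} k fuel → (∀ {ℓ} → Walk Γ x y ℓ → k ℕ.≤ ℓ) →
             Walk Γ x y (k ℕ.+ fuel) → ∃[ d ] Distance Γ x y d
  shortest {x} {y} k fuel bound w with walk? k x y
  ... | yes v = k , v , bound
  shortest {x} {y} k zero bound w | no ¬v =
    contradiction (≡.subst (Walk Γ x y) (ℕ.+-identityʳ k) w) ¬v
  shortest {x} {y} k (suc fuel) bound w | no ¬v =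
    shortest (suc k) fuel (λ v → ℕ.≤∧≢⇒< (bound v) λ { ≡.refl → ¬v v })
      (≡.subst (Walk Γ x y) (ℕ.+-suc k fuel) w)

  Distance-unique : ∀ {x y d d′} → Distance Γ x y d → Distance Γ x y d′ → d ≡ d′
  Distance-unique (w , min) (w′ , min′) = ℕ.≤-antisym (min w′) (min′ w)

  Distance-refl : ∀ x → Distance Γ x x 0
  Distance-refl x = [] , λ _ → z≤n

  Distance-0⇒≡ : ∀ {x y} → Distance Γ x y 0 → x ≡ y
  Distance-0⇒≡ ([] , _) = ≡.refl

  ∼⇒Distance-1 : ∀ {x y} → x ∼ y → Distance Γ x y 1
  ∼⇒Distance-1 {x} {y} x∼y = (x∼y ∷ []) , bound
    where
    bound : ∀ {ℓ} → Walk Γ x y ℓ → 1 ℕ.≤ ℓ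
    bound []      = contradiction x∼y (irrefl ≡.refl)
    bound (_ ∷ _) = s≤s z≤n

  Distance-step : ∀ {x y z d e} → y ∼ z → Distance Γ x y d → Distance Γ x z e → e ℕ.≤ suc d
  Distance-step {d = d} {e} y∼z (w , _) (_ , min) =
    ≡.subst (e ℕ.≤_) (ℕ.+-comm d 1) (min (w ◅◅ (y∼z ∷ [])))

  Distance-neighbours : ∀ {x y z d e} → y ∼ z → Distance Γ x y d → Distance Γ x z e →
                        suc e ≡ d ⊎ e ≡ d ⊎ e ≡ suc d
  Distance-neighbours {d = d} {e} y∼z dxy dxz with ℕ.m≤n⇒m<n∨m≡n (Distance-step y∼z dxy dxz)
  ... | inj₂ e≡1+d = inj₂ (inj₂ e≡1+d)
  ... | inj₁ (s≤s e≤d) with ℕ.m≤n⇒m<n∨m≡n e≤d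
  ...   | inj₂ e≡d = inj₂ (inj₁ e≡d)
  ...   | inj₁ e<d = inj₁ (ℕ.≤-antisym e<d (Distance-step (sym y∼z) dxz dxy))

  -- A single geodesic provides witnesses for all distances: `x`, `p`, `q`, `y` lie at distance 0,
  -- 1, 2, 3 from `x`. Intersection numbers are read off at these vertices.
  record Geodesic₃ : Set where
    field
      {x p q y} : Fin n
      x∼p : x ∼ p
      p∼q : p ∼ q
      q∼y : q ∼ y
      d-xy : Distance Γ x y 3

    d-xp : Distance Γ x p 1
    d-xp = ∼⇒Distance-1 x∼p

    d-xq : Distance Γ x q 2
    -- A shorter walk to `q`, prolonged by `q ∼ y`, would undercut the distance three from `x` to
    -- `y`.
    d-xq = (x∼p ∷ (p∼q ∷ [])) , λ {ℓ} w →
      ℕ.+-cancelˡ-≤ 1 2 ℓ (≡.subst (3 ℕ.≤_) (ℕ.+-comm ℓ 1) (proj₂ d-xy (w ◅◅ (q∼y ∷ []))))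

  geodesic₃ : ∀ {x y} → Distance Γ x y 3 → Geodesic₃
  geodesic₃ d@((x∼p ∷ (p∼q ∷ (q∼y ∷ []))) , _) =
    record { x∼p = x∼p ; p∼q = p∼q ; q∼y = q∼y ; d-xy = d }

-- Cardinalities of subsets

∣∣-empty : ∀ {n} {S : Subset n} → (∀ z → z ∉ S) → ∣ S ∣ ≡ 0
∣∣-empty {n} {S} empty = ≡.trans (≡.cong ∣_∣ (Subset.Empty-unique λ (z , z∈S) → empty z z∈S)) (Subset.∣⊥∣≡0 n)

∣∣-singleton : ∀ {n} {S : Subset n} x → (∀ z → z ∈ S ⇔ z ≡ x) → ∣ S ∣ ≡ 1
∣∣-singleton {S = S} x S⇔x = ≡.trans (≡.cong ∣_∣ S≡⁅x⁆) (Subset.∣⁅x⁆∣≡1 x)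
  where
  S≡⁅x⁆ : S ≡ ⁅ x ⁆
  S≡⁅x⁆ = Subset.⊆-antisym
    (λ {z} z∈S → ≡.subst (_∈ ⁅ x ⁆) (≡.sym (Equivalence.to (S⇔x z) z∈S)) (Subset.x∈⁅x⁆ x))
    (λ {z} z∈⁅x⁆ → Equivalence.from (S⇔x z) (Subset.x∈⁅y⁆⇒x≡y x z∈⁅x⁆))

∣∣-inhabited : ∀ {n} {S : Subset n} {x} → x ∈ S → 0 ℕ.< ∣ S ∣
∣∣-inhabited here = s≤s z≤n
∣∣-inhabited {S = true  ∷ S} (there x∈S) = s≤s z≤n
∣∣-inhabited {S = false ∷ S} (there x∈S) = ∣∣-inhabited x∈S

-- Intersection numbers in diameter three

module DistanceRegular₃ (Γ : DistanceRegularGraph 3) where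
  open DistanceRegularGraph Γ public
  open IsDistanceRegular isDistanceRegular public
  open Graph graph public
  open Walks graph public

  distance : ∀ x y → ∃[ d ] Distance graph x y d
  distance x y with ℓ , w ← connected x y = shortest 0 ℓ (λ _ → z≤n) w

  dist : Fin order → Fin order → ℕ
  dist x y = proj₁ (distance x y)

  Distance-dist : ∀ x y → Distance graph x y (dist x y)
  Distance-dist x y = proj₂ (distance x y)

  dist-≡ : ∀ {x y d} → Distance graph x y d → dist x y ≡ d
  dist-≡ {x} {y} = Distance-unique (Distance-dist x y)

  dist≤3 : ∀ x y → dist x y ℕ.≤ 3
  dist≤3 x y = proj₁ diameter (Distance-dist x y)

  geodesic : Geodesic₃
  geodesic = geodesic₃ (proj₂ (proj₂ (proj₂ diameter)))

  open Geodesic₃ geodesic public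

  c₀≡0 : c[ 0F ] ≡ 0
  c₀≡0 with S , S⇔ , eq ← c-count 0F (Distance-refl x) =
    ≡.trans (≡.sym eq) (∣∣-empty λ z z∈S → case (Equivalence.to (S⇔ z) z∈S))
    where
    case : ∀ {A : Set} {B : ℕ → Set} → ¬ (A × ∃[ j ] (suc j ≡ 0 × B j))
    case (_ , _ , () , _)

  c₁≡1 : c[ 1F ] ≡ 1
  c₁≡1 with S , S⇔ , eq ← c-count 1F d-xp = ≡.trans (≡.sym eq) (∣∣-singleton x λ z → mk⇔
    (λ z∈S → to′ (Equivalence.to (S⇔ z) z∈S))
    (λ { ≡.refl → Equivalence.from (S⇔ x) (sym x∼p , 0 , ≡.refl , Distance-refl x) }))
    where
    to′ : ∀ {z} → p ∼ z × ∃[ j ] (suc j ≡ 1 × Distance graph x z j) → z ≡ x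
    to′ (_ , _ , ≡.refl , d) = ≡.sym (Distance-0⇒≡ d)

  b₃≡0 : b[ 3F ] ≡ 0
  b₃≡0 with S , S⇔ , eq ← b-count 3F d-xy = ≡.trans (≡.sym eq) (∣∣-empty λ z z∈S →
    contradiction (proj₁ diameter (proj₂ (Equivalence.to (S⇔ z) z∈S))) (ℕ.<-irrefl ≡.refl))

  0<b₂ : 0 ℕ.< b[ 2F ]
  0<b₂ with S , S⇔ , eq ← b-count 2F d-xq =
    ≡.subst (0 ℕ.<_) eq (∣∣-inhabited (Equivalence.from (S⇔ y) (q∼y , d-xy)))

  0<c₂ : 0 ℕ.< c[ 2F ]
  0<c₂ with S , S⇔ , eq ← c-count 2F d-xq =
    ≡.subst (0 ℕ.<_) eq (∣∣-inhabited (Equivalence.from (S⇔ p) (sym p∼q , 1 , ≡.refl , d-xp)))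

  0<c₃ : 0 ℕ.< c[ 3F ]
  0<c₃ with S , S⇔ , eq ← c-count 3F d-xy =
    ≡.subst (0 ℕ.<_) eq (∣∣-inhabited (Equivalence.from (S⇔ q) (sym q∼y , 2 , ≡.refl , d-xq)))

module SpectralTheory {ℓ₀ ℓ₁ ℓ₂ ℓ₃} (ℝ : RealField ℓ₀ ℓ₁ ℓ₂ ℓ₃) where

  open RealField ℝ hiding (zero)
  open HeytingCommutativeRing heytingCommutativeRing using (commutativeRing)
  open CommutativeRing commutativeRing using (ring)
  open HeytingProperties heytingCommutativeRing using (#-congʳ; 1#0; x-0≈x)
  open RingProperties ring
    using (-0#≈0#; -‿involutive; -‿distribˡ-*; -‿distribʳ-*; -‿+-comm)
  open SemiringExp semiring using (_^_)
  open SemiringMult semiring using (×-homo-+; ×1-homo-*)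
  open SemiringSum semiring
    using (sum-syntax; sum-cong-≋; ∑-distrib-+; ∑-comm; *-distribˡ-sum; *-distribʳ-sum; sum-replicate; sum-replicate-zero)
  open Spectral ℝ
  open SetoidReasoning setoid

  module < = IsStrictPartialOrder isStrictPartialOrder

  -- The integers inside the field

  fromℤ-⊖ : ∀ m n → fromℤ (m ℤ.⊖ n) ≈ m ×# 1# - n ×# 1#
  fromℤ-⊖ m zero = sym (trans (+-congˡ -0#≈0#) (+-identityʳ _))
  fromℤ-⊖ zero (suc n) = sym (+-identityˡ _)
  fromℤ-⊖ (suc m) (suc n) = begin
    fromℤ (suc m ℤ.⊖ suc n)               ≡⟨ ≡.cong fromℤ (ℤ.[1+m]⊖[1+n]≡m⊖n m n) ⟩
    fromℤ (m ℤ.⊖ n)                       ≈⟨ fromℤ-⊖ m n ⟩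
    m ×# 1# - n ×# 1#                     ≈⟨ +-congʳ (trans (+-congˡ (-‿inverseʳ 1#)) (+-identityʳ _)) ⟨
    m ×# 1# + (1# - 1#) - n ×# 1#         ≈⟨ +-congʳ (+-assoc _ _ _) ⟨
    m ×# 1# + 1# - 1# - n ×# 1#           ≈⟨ +-assoc _ _ _ ⟩
    m ×# 1# + 1# + (- 1# - n ×# 1#)       ≈⟨ +-cong (+-comm _ _) (-‿+-comm _ _) ⟩
    suc m ×# 1# - suc n ×# 1#             ∎

  fromℤ-‿homo : ∀ i → fromℤ (ℤ.- i) ≈ - fromℤ i
  fromℤ-‿homo (+ zero)  = sym -0#≈0#
  fromℤ-‿homo (+ suc n) = refl
  fromℤ-‿homo -[1+ n ]  = sym (-‿involutive _)

  fromℤ-+-homo : ∀ i j → fromℤ (i ℤ.+ j) ≈ fromℤ i + fromℤ j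
  fromℤ-+-homo (+ m)    (+ n)    = ×-homo-+ 1# m n
  fromℤ-+-homo (+ m)    -[1+ n ] = fromℤ-⊖ m (suc n)
  fromℤ-+-homo -[1+ m ] (+ n)    = trans (fromℤ-⊖ n (suc m)) (+-comm _ _)
  fromℤ-+-homo -[1+ m ] -[1+ n ] = begin
    - (suc (suc (m ℕ.+ n)) ×# 1#)     ≡⟨ ≡.cong (λ k → - (suc k ×# 1#)) (ℕ.+-suc m n) ⟨
    - ((suc m ℕ.+ suc n) ×# 1#)       ≈⟨ -‿cong (×-homo-+ 1# (suc m) (suc n)) ⟩
    - (suc m ×# 1# + suc n ×# 1#)     ≈⟨ -‿+-comm _ _ ⟨
    - (suc m ×# 1#) - suc n ×# 1#     ∎

  fromℤ-pos-* : ∀ m n → fromℤ (+ m ℤ.* + n) ≈ m ×# 1# * (n ×# 1#)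
  fromℤ-pos-* m n = begin
    fromℤ (+ m ℤ.* + n)     ≡⟨ ≡.cong fromℤ (ℤ.pos-* m n) ⟨
    (m ℕ.* n) ×# 1#         ≈⟨ ×1-homo-* m n ⟩
    m ×# 1# * (n ×# 1#)     ∎

  fromℤ-ℕ-* : ∀ m j → fromℤ (+ m ℤ.* j) ≈ m ×# 1# * fromℤ j
  fromℤ-ℕ-* m (+ n) = fromℤ-pos-* m n
  fromℤ-ℕ-* m -[1+ n ] = begin
    fromℤ (+ m ℤ.* ℤ.- + suc n)     ≡⟨ ≡.cong fromℤ (ℤ.neg-distribʳ-* (+ m) (+ suc n)) ⟨
    fromℤ (ℤ.- (+ m ℤ.* + suc n))   ≈⟨ fromℤ-‿homo (+ m ℤ.* + suc n) ⟩
    - fromℤ (+ m ℤ.* + suc n)       ≈⟨ -‿cong (fromℤ-pos-* m (suc n)) ⟩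
    - (m ×# 1# * (suc n ×# 1#))     ≈⟨ -‿distribʳ-* _ _ ⟩
    m ×# 1# * - (suc n ×# 1#)       ∎
  fromℤ-*-homo : ∀ i j → fromℤ (i ℤ.* j) ≈ fromℤ i * fromℤ j
  fromℤ-*-homo (+ m)    j = fromℤ-ℕ-* m j
  fromℤ-*-homo -[1+ m ] j = begin
    fromℤ (ℤ.- + suc m ℤ.* j)       ≡⟨ ≡.cong fromℤ (ℤ.neg-distribˡ-* (+ suc m) j) ⟨
    fromℤ (ℤ.- (+ suc m ℤ.* j))     ≈⟨ fromℤ-‿homo (+ suc m ℤ.* j) ⟩
    - fromℤ (+ suc m ℤ.* j)         ≈⟨ -‿cong (fromℤ-ℕ-* (suc m) j) ⟩
    - (suc m ×# 1# * fromℤ j)       ≈⟨ -‿distribˡ-* _ _ ⟩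
    - (suc m ×# 1#) * fromℤ j       ∎

  fromℤ-minus : ∀ i j → fromℤ (i ℤ.- j) ≈ fromℤ i - fromℤ j
  fromℤ-minus i j = trans (fromℤ-+-homo i (ℤ.- j)) (+-congˡ (fromℤ-‿homo j))

  fromℤ-morphism : ℤ.+-*-rawRing -Raw-AlmostCommutative⟶ fromCommutativeRing commutativeRing
  fromℤ-morphism = record
    { ⟦_⟧    = fromℤ
    ; +-homo = fromℤ-+-homo
    ; *-homo = fromℤ-*-homo
    ; -‿homo = fromℤ-‿homo
    ; 0-homo = refl
    ; 1-homo = +-identityʳ 1#
    }

  fromℤ≟ : ∀ i j → Maybe (fromℤ i ≈ fromℤ j)
  fromℤ≟ i j with i ℤ.≟ j
  ... | yes i≡j = just (reflexive (≡.cong fromℤ i≡j))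
  ... | no  _   = nothing

  open RingSolver ℤ.+-*-rawRing (fromCommutativeRing commutativeRing) fromℤ-morphism fromℤ≟
    using (solve; _:+_; _:*_; _:-_; :-_; con; _:=_)

  -- Cancellation by apartness, and descent to the integers

  x-y≈0⇒x≈y : ∀ {x y} → x - y ≈ 0# → x ≈ y
  x-y≈0⇒x≈y {x} {y} x-y≈0 = begin
    x            ≈⟨ solve 2 (λ x y → x := x :- y :+ y) refl x y ⟩
    x - y + y    ≈⟨ +-congʳ x-y≈0 ⟩
    0# + y       ≈⟨ +-identityˡ y ⟩
    y            ∎

  x≈y⇒x-y≈0 : ∀ {x y} → x ≈ y → x - y ≈ 0#
  x≈y⇒x-y≈0 {x} {y} x≈y = trans (+-congʳ x≈y) (-‿inverseʳ y)

  #-cancelˡ : ∀ {x y z w} → x # y → (x - y) * z ≈ (x - y) * w → z ≈ w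
  #-cancelˡ {x} {y} {z} {w} x#y eq with d⁻¹ , d⁻¹d≈1 , _ ← #⇒invertible x#y = begin
    z                      ≈⟨ *-identityˡ z ⟨
    1# * z                 ≈⟨ *-congʳ d⁻¹d≈1 ⟨
    d⁻¹ * (x - y) * z      ≈⟨ *-assoc _ _ _ ⟩
    d⁻¹ * ((x - y) * z)    ≈⟨ *-congˡ eq ⟩
    d⁻¹ * ((x - y) * w)    ≈⟨ *-assoc _ _ _ ⟨
    d⁻¹ * (x - y) * w      ≈⟨ *-congʳ d⁻¹d≈1 ⟩
    1# * w                 ≈⟨ *-identityˡ w ⟩
    w                      ∎

  #-zero-product : ∀ {x y z} → x # y → (x - y) * z ≈ 0# → z ≈ 0#
  #-zero-product x#y eq = #-cancelˡ x#y (trans eq (sym (zeroʳ _)))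

  #0-zero-product : ∀ {x z} → x # 0# → x * z ≈ 0# → z ≈ 0#
  #0-zero-product x#0 eq = #-zero-product x#0 (trans (*-congʳ (x-0≈x _)) eq)

  <⇒# : ∀ {x y} → x < y → y # x
  <⇒# x<y = Equivalence.from #⇔<⊎> (inj₂ x<y)

  0<1 : 0# < 1#
  0<1 with Equivalence.to #⇔<⊎> 1#0
  ... | inj₂ 0<1 = 0<1
  ... | inj₁ 1<0 = contradiction (<.trans 1<0 (<.<-respʳ-≈ -1*-1≈1 (*-pos 0<-1 0<-1))) (<.irrefl refl)
    where
    0<-1 : 0# < - 1#
    0<-1 = <.<-respˡ-≈ (-‿inverseʳ 1#) (<.<-respʳ-≈ (+-identityˡ _) (+-monoˡ-< (- 1#) 1<0))

    -1*-1≈1 : - 1# * - 1# ≈ 1#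
    -1*-1≈1 = trans (solve 1 (λ x → :- x :* :- x := x :* x) refl 1#) (*-identityˡ 1#)

  0<suc : ∀ n → 0# < suc n ×# 1#
  0<suc zero    = <.<-respʳ-≈ (sym (+-identityʳ 1#)) 0<1
  0<suc (suc n) = <.trans (0<suc n) (<.<-respˡ-≈ (+-identityˡ _) (+-monoˡ-< (suc n ×# 1#) 0<1))

  fromℤ-mono-< : ∀ {i j} → i ℤ.< j → fromℤ i < fromℤ j
  fromℤ-mono-< {i} {j} i<j with j ℤ.- i in eq | i<j⇒0<j-i i<j
  ... | + zero  | +<+ ()
  ... | + suc n | _ = <.<-respˡ-≈ (+-identityˡ _) (<.<-respʳ-≈ eq′ (+-monoˡ-< (fromℤ i) (0<suc n)))
    where
    eq′ : suc n ×# 1# + fromℤ i ≈ fromℤ j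
    eq′ = begin
      suc n ×# 1# + fromℤ i        ≡⟨ ≡.cong (λ k → fromℤ k + fromℤ i) eq ⟨
      fromℤ (j ℤ.- i) + fromℤ i    ≈⟨ +-congʳ (fromℤ-minus j i) ⟩
      fromℤ j - fromℤ i + fromℤ i  ≈⟨ solve 2 (λ j i → j :- i :+ i := j) refl (fromℤ j) (fromℤ i) ⟩
      fromℤ j                      ∎

  -- The order of the field forces characteristic zero. Through this lemma equations proved in the
  -- field become equations in ℤ, where order is decidable.
  fromℤ-injective : ∀ {i j} → fromℤ i ≈ fromℤ j → i ≡ j
  fromℤ-injective {i} {j} eq with ℤ.<-cmp i j
  ... | tri< i<j _ _ = contradiction (fromℤ-mono-< i<j) (<.irrefl eq)
  ... | tri≈ _ i≡j _ = i≡j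
  ... | tri> _ _ j<i = contradiction (fromℤ-mono-< j<i) (<.irrefl (sym eq))

  positive#0 : ∀ {n} → 0 ℕ.< n → n ×# 1# # 0#
  positive#0 {suc n} _ = <⇒# (0<suc n)

  -- A record and not a synonym, so that `i` and `x` can be inferred from a proof. The combinators
  -- below build the integer form of a field expression along its syntax.
  record _↦_ (i : ℤ) (x : Carrier) : Set ℓ₁ where
    constructor ↦_
    field fromℤ-≈ : fromℤ i ≈ x

  open _↦_

  infixl 6 _⊕_ _⊖_
  infixl 7 _⊗_
  infix 4 _↦_

  int : ∀ i → i ↦ fromℤ i
  int i = ↦ refl

  _⊕_ : ∀ {i j x y} → i ↦ x → j ↦ y → i ℤ.+ j ↦ x + y
  _⊕_ {i} {j} (↦ p) (↦ q) = ↦ trans (fromℤ-+-homo i j) (+-cong p q)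

  _⊖_ : ∀ {i j x y} → i ↦ x → j ↦ y → i ℤ.- j ↦ x - y
  _⊖_ {i} {j} (↦ p) (↦ q) = ↦ trans (fromℤ-minus i j) (+-cong p (-‿cong q))

  _⊗_ : ∀ {i j x y} → i ↦ x → j ↦ y → i ℤ.* j ↦ x * y
  _⊗_ {i} {j} (↦ p) (↦ q) = ↦ trans (fromℤ-*-homo i j) (*-cong p q)

  ↦-injective : ∀ {i j x y} → i ↦ x → j ↦ y → x ≈ y → i ≡ j
  ↦-injective (↦ p) (↦ q) x≈y = fromℤ-injective (trans p (trans x≈y (sym q)))

  -- Finite sums and the identity matrix

  ∑-cong : ∀ {n} {f g : Fin n → Carrier} → (∀ x → f x ≈ g x) → ∑[ x < n ] f x ≈ ∑[ x < n ] g x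
  ∑-cong = sum-cong-≋

  ∑-zero : ∀ {n} {f : Fin n → Carrier} → (∀ x → f x ≈ 0#) → ∑[ x < n ] f x ≈ 0#
  ∑-zero {n} f≈0 = trans (∑-cong f≈0) (sum-replicate-zero n)

  ∑-minus : ∀ {n} (f g : Fin n → Carrier) →
            ∑[ x < n ] (f x - g x) ≈ ∑[ x < n ] f x - ∑[ x < n ] g x
  ∑-minus {n} f g = begin
    ∑[ x < n ] (f x - g x)                                    ≈⟨ solve 2 (λ s t → s := s :+ t :- t) refl _ _ ⟩
    ∑[ x < n ] (f x - g x) + ∑[ x < n ] g x - ∑[ x < n ] g x  ≈⟨ +-congʳ (∑-distrib-+ _ g) ⟨
    ∑[ x < n ] (f x - g x + g x) - ∑[ x < n ] g x             ≈⟨ +-congʳ (∑-cong λ x → solve 2 (λ s t → s :- t :+ t := s) refl (f x) (g x)) ⟩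
    ∑[ x < n ] f x - ∑[ x < n ] g x                           ∎

  δ : ∀ {n} → Fin n → Fin n → Carrier
  δ x y = if does (x Fin.≟ y) then 1# else 0#

  δ-refl : ∀ {n} (x : Fin n) → δ x x ≈ 1#
  δ-refl x = reflexive (≡.cong (if_then 1# else 0#) (dec-true (x Fin.≟ x) ≡.refl))

  δ-symmetric : ∀ {n} (x y : Fin n) → δ x y ≈ δ y x
  δ-symmetric zero    zero    = refl
  δ-symmetric zero    (suc y) = refl
  δ-symmetric (suc x) zero    = refl
  δ-symmetric (suc x) (suc y) = δ-symmetric x y

  ∑-δ : ∀ {n} x (f : Fin n → Carrier) → ∑[ y < n ] (δ x y * f y) ≈ f x
  ∑-δ {suc n} zero f = begin
    1# * f zero + ∑[ y < n ] (0# * f (suc y))  ≈⟨ +-cong (*-identityˡ _) (∑-zero {n} λ y → zeroˡ _) ⟩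
    f zero + 0#                                ≈⟨ +-identityʳ _ ⟩
    f zero                                     ∎
  ∑-δ {suc n} (suc x) f = begin
    0# * f zero + ∑[ y < n ] (δ x y * f (suc y))  ≈⟨ +-cong (zeroˡ _) (∑-δ x (λ y → f (suc y))) ⟩
    0# + f (suc x)                                ≈⟨ +-identityˡ _ ⟩
    f (suc x)                                     ∎

  -- Polynomials as operators on sequences

  ∏[_-_] : Carrier → List Carrier → Carrier
  ∏[ μ - as ] = foldr (λ a r → (μ - a) * r) 1# as

  -- A sequence σ is read as the linear functional X ^ j ↦ σ j on polynomials;
  -- Δ a is then multiplication by X - a.
  opaque

    Δ : Carrier → (ℕ → Carrier) → ℕ → Carrier
    Δ a σ j = σ (suc j) - a * σ j

    Δ-unfold : ∀ a σ j → Δ a σ j ≈ σ (suc j) - a * σ j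
    Δ-unfold a σ j = refl

  -- `Δs as σ 0` is the value of the functional `σ` at the polynomial ∏ (X - a). If `σ j` is an
  -- entry of the j-th power of a matrix, it is the same entry of ∏ (M - a), so products of shifted
  -- matrices never have to be formed.
  Δs : List Carrier → (ℕ → Carrier) → ℕ → Carrier
  Δs as σ = foldr Δ σ as

  opaque
    unfolding Δ

    Δ-cong : ∀ a {σ τ} → (∀ j → σ j ≈ τ j) → ∀ j → Δ a σ j ≈ Δ a τ j
    Δ-cong a σ≈τ j = +-cong (σ≈τ (suc j)) (-‿cong (*-congˡ (σ≈τ j)))

    Δs-cong : ∀ as {σ τ} → (∀ j → σ j ≈ τ j) → ∀ j → Δs as σ j ≈ Δs as τ j
    Δs-cong []       σ≈τ = σ≈τ
    Δs-cong (a ∷ as) σ≈τ = Δ-cong a (Δs-cong as σ≈τ)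

    Δ-comm : ∀ a b σ j → Δ a (Δ b σ) j ≈ Δ b (Δ a σ) j
    Δ-comm a b σ j = solve 5 (λ a b x y z → z :- b :* y :- a :* (y :- b :* x) := z :- a :* y :- b :* (y :- a :* x))
      refl a b (σ j) (σ (suc j)) (σ (suc (suc j)))

    Δs-shift : ∀ as σ j → Δs as (λ i → σ (suc i)) j ≈ Δs as σ (suc j)
    Δs-shift []       σ j = refl
    Δs-shift (a ∷ as) σ j = Δ-cong a (Δs-shift as σ) j

    Δs-* : ∀ as x σ j → Δs as (λ i → x * σ i) j ≈ x * Δs as σ j
    Δs-* []       x σ j = refl
    Δs-* (a ∷ as) x σ j = begin
      Δ a (Δs as (λ i → x * σ i)) j                    ≈⟨ Δ-cong a (Δs-* as x σ) j ⟩
      x * Δs as σ (suc j) - a * (x * Δs as σ j)        ≈⟨ solve 4 (λ a x y z → x :* y :- a :* (x :* z) := x :* (y :- a :* z)) refl a x _ _ ⟩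
      x * (Δs as σ (suc j) - a * Δs as σ j)            ∎

    Δs-+ : ∀ as σ τ j → Δs as (λ i → σ i + τ i) j ≈ Δs as σ j + Δs as τ j
    Δs-+ []       σ τ j = refl
    Δs-+ (a ∷ as) σ τ j = begin
      Δ a (Δs as (λ i → σ i + τ i)) j          ≈⟨ Δ-cong a (Δs-+ as σ τ) j ⟩
      Δs as σ (suc j) + Δs as τ (suc j) - a * (Δs as σ j + Δs as τ j)
        ≈⟨ solve 5 (λ a s s′ t t′ → s :+ t :- a :* (s′ :+ t′) := s :- a :* s′ :+ (t :- a :* t′)) refl a _ _ _ _ ⟩
      Δ a (Δs as σ) j + Δ a (Δs as τ) j        ∎

    Δs-0 : ∀ as j → Δs as (λ _ → 0#) j ≈ 0#
    Δs-0 []       j = refl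
    Δs-0 (a ∷ as) j = trans (Δ-cong a (Δs-0 as) j) (solve 1 (λ a → con (+ 0) :- a :* con (+ 0) := con (+ 0)) refl a)

    Δs-∑ : ∀ {n} as (σ : Fin n → ℕ → Carrier) j →
           Δs as (λ i → ∑[ x < n ] σ x i) j ≈ ∑[ x < n ] Δs as (σ x) j
    Δs-∑ {zero}  as σ j = Δs-0 as j
    Δs-∑ {suc n} as σ j = trans (Δs-+ as _ _ j) (+-congˡ (Δs-∑ as (λ x → σ (suc x)) j))

    -- The sequence of powers of `μ` is evaluation at `μ`, so multiplication by X - a only scales it
    -- by `μ - a`.
    Δs-power : ∀ as μ j → Δs as (μ ^_) j ≈ ∏[ μ - as ] * μ ^ j
    Δs-power []       μ j = sym (*-identityˡ _)
    Δs-power (a ∷ as) μ j = begin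
      Δ a (Δs as (μ ^_)) j                                      ≈⟨ Δ-cong a (Δs-power as μ) j ⟩
      ∏[ μ - as ] * (μ * μ ^ j) - a * (∏[ μ - as ] * μ ^ j)     ≈⟨ solve 4 (λ a μ p r → p :* (μ :* r) :- a :* (p :* r) := (μ :- a) :* p :* r) refl a μ _ _ ⟩
      (μ - a) * ∏[ μ - as ] * μ ^ j                             ∎

    -- (X - b) - (X - a) is the constant `a - b`, which apartness makes invertible.
    Δ-cancel : ∀ {a b σ} → a # b → Δ a σ 0 ≈ 0# → Δ b σ 0 ≈ 0# → σ 0 ≈ 0#
    Δ-cancel {a} {b} {σ} a#b Δa≈0 Δb≈0 = #-zero-product a#b (begin
      (a - b) * σ 0        ≈⟨ solve 4 (λ a b s t → (a :- b) :* s := t :- b :* s :- (t :- a :* s)) refl a b (σ 0) (σ 1) ⟩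
      Δ b σ 0 - Δ a σ 0    ≈⟨ +-cong Δb≈0 (-‿cong Δa≈0) ⟩
      0# - 0#              ≈⟨ -‿inverseʳ 0# ⟩
      0#                   ∎)

    next≈0 : ∀ {a σ} → σ 0 ≈ 0# → Δ a σ 0 ≈ 0# → σ 1 ≈ 0#
    next≈0 {a} {σ} σ0≈0 Δ≈0 = begin
      σ 1                  ≈⟨ x-y≈0⇒x≈y Δ≈0 ⟩
      a * σ 0              ≈⟨ *-congˡ σ0≈0 ⟩
      a * 0#               ≈⟨ zeroʳ a ⟩
      0#                   ∎

  opaque
    unfolding Δ

    -- The coefficients are grouped by `b + c` and `b * c` because only the sum and the product of
    -- θ₂ and θ₃ are known.
    Δs-three : ∀ a b c σ → Δs (a ∷ b ∷ c ∷ []) σ 0 ≈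
      σ 3 - (a + (b + c)) * σ 2 + (b * c + a * (b + c)) * σ 1 - a * (b * c) * σ 0
    Δs-three a b c σ = solve 7 (λ a b c x y z w →
        w :- c :* z :- b :* (z :- c :* y) :- a :* (z :- c :* y :- b :* (y :- c :* x)) :=
        w :- (a :+ (b :+ c)) :* z :+ (b :* c :+ a :* (b :+ c)) :* y :- a :* (b :* c) :* x)
      refl a b c (σ 0) (σ 1) (σ 2) (σ 3)

  -- The products of three of the four factors X - θᵢ span the polynomials of
  -- degree at most three.
  cubics-span : ∀ {a b c d} {σ : ℕ → Carrier} →
                a # b → a # c → a # d → b # c → b # d → c # d →
                Δs (b ∷ c ∷ d ∷ []) σ 0 ≈ 0# → Δs (a ∷ c ∷ d ∷ []) σ 0 ≈ 0# →
                Δs (a ∷ b ∷ d ∷ []) σ 0 ≈ 0# → Δs (a ∷ b ∷ c ∷ []) σ 0 ≈ 0# →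
                σ 0 ≈ 0# × σ 1 ≈ 0# × σ 2 ≈ 0#
  cubics-span {a} {b} {c} {d} {σ} a#b a#c a#d b#c b#d c#d bcd acd abd abc =
    σ0 , σ1 , next≈0 {d} {λ j → σ (suc j)} σ1 (trans (Δs-shift (d ∷ []) σ 0) (next≈0 {c} {Δ d σ} d′ cd))
    where
    -- Two products that differ in one factor yield their common part by `Δ-cancel`: the cubics give
    -- the quadratics `cd`, `bd`, `bc`, these the linear factors `d′`, `c′`, and these the
    -- constants.
    cd : Δ c (Δ d σ) 0 ≈ 0#
    cd = Δ-cancel {σ = Δ c (Δ d σ)} a#b acd bcd

    bd : Δ b (Δ d σ) 0 ≈ 0#
    bd = Δ-cancel {σ = Δ b (Δ d σ)} a#c abd (trans (Δ-comm c b (Δ d σ) 0) bcd)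

    bc : Δ b (Δ c σ) 0 ≈ 0#
    bc = Δ-cancel {σ = Δ b (Δ c σ)} a#d abc (begin
      Δ d (Δ b (Δ c σ)) 0  ≈⟨ Δ-comm d b (Δ c σ) 0 ⟩
      Δ b (Δ d (Δ c σ)) 0  ≈⟨ Δ-cong b (Δ-comm d c σ) 0 ⟩
      Δ b (Δ c (Δ d σ)) 0  ≈⟨ bcd ⟩
      0#                   ∎)

    d′ : Δ d σ 0 ≈ 0#
    d′ = Δ-cancel {σ = Δ d σ} b#c bd cd

    c′ : Δ c σ 0 ≈ 0#
    c′ = Δ-cancel {σ = Δ c σ} b#d bc (trans (Δ-comm d c σ 0) cd)

    σ0 : σ 0 ≈ 0#
    σ0 = Δ-cancel {σ = σ} c#d c′ d′

    σ1 : σ 1 ≈ 0#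
    σ1 = next≈0 {c} {σ} σ0 c′

  -- Traces and multiplicities

  module _ {n m} {μ : Carrier} {ℓ} {V : Vector Carrier n → Set ℓ}
           (B : Vector (Vector Carrier n) m) (isBasis : IsBasis V B) where
    open IsBasis isBasis

    -- Expanding the columns of `N` in the basis factors `N` as B t, and tr (B t) = tr (t B). The
    -- product t B, whose entries are `coefficient`, is `m` by `m`. Since `N` scales each basis
    -- vector by `μ`, independence identifies it with `μ` times the identity.
    trace-multiple-of-projection :
      (N : Matrix n) → (∀ y → V (λ x → N x y)) →
      (∀ v → V v → ∀ x → (N *ᵥ v) x ≈ μ * v x) →
      ∑[ x < n ] N x x ≈ m ×# 1# * μ
    trace-multiple-of-projection N col scales = begin
      ∑[ x < n ] N x x                           ≈⟨ ∑-cong (λ x → proj₂ (spanning _ (col x)) x) ⟩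
      ∑[ x < n ] ∑[ l < m ] (t x l * B l x)      ≈⟨ ∑-comm {n} {m} (λ x l → t x l * B l x) ⟩
      ∑[ l < m ] ∑[ x < n ] (t x l * B l x)      ≈⟨ ∑-cong {m} diagonal ⟩
      ∑[ l < m ] μ                               ≈⟨ ∑-cong {m} (λ _ → sym (*-identityˡ μ)) ⟩
      ∑[ l < m ] (1# * μ)                        ≈⟨ *-distribʳ-sum {m} μ (λ _ → 1#) ⟨
      (∑[ l < m ] 1#) * μ                        ≈⟨ *-congʳ (sum-replicate m) ⟩
      m ×# 1# * μ                                ∎
      where
      t : Fin n → Fin m → Carrier
      t y = proj₁ (spanning _ (col y))

      coefficient : Fin m → Fin m → Carrier
      coefficient j l = ∑[ y < n ] (t y l * B j y)

      expand : ∀ j x → combination (coefficient j) B x ≈ μ * B j x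
      expand j x = begin
        ∑[ l < m ] (coefficient j l * B l x)                     ≈⟨ ∑-cong {m} (λ l → *-distribʳ-sum (B l x) (λ y → t y l * B j y)) ⟩
        ∑[ l < m ] ∑[ y < n ] (t y l * B j y * B l x)            ≈⟨ ∑-comm {m} {n} (λ l y → t y l * B j y * B l x) ⟩
        ∑[ y < n ] ∑[ l < m ] (t y l * B j y * B l x)            ≈⟨ ∑-cong {n} (λ y → ∑-cong {m} (λ l →
                                                                      solve 3 (λ p q r → p :* q :* r := p :* r :* q) refl _ _ _)) ⟩
        ∑[ y < n ] ∑[ l < m ] (t y l * B l x * B j y)            ≈⟨ ∑-cong {n} (λ y → *-distribʳ-sum (B j y) (λ l → t y l * B l x)) ⟨
        ∑[ y < n ] ((∑[ l < m ] (t y l * B l x)) * B j y)        ≈⟨ ∑-cong {n} (λ y → *-congʳ (proj₂ (spanning _ (col y)) x)) ⟨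
        ∑[ y < n ] (N x y * B j y)                               ≈⟨ scales (B j) (member j) x ⟩
        μ * B j x                                                ∎

      residual : ∀ j x → combination (λ l → coefficient j l - δ j l * μ) B x ≈ 0#
      residual j x = begin
        ∑[ l < m ] ((coefficient j l - δ j l * μ) * B l x)
          ≈⟨ ∑-cong {m} (λ l → solve 4 (λ p q r s → (p :- q :* r) :* s := p :* s :- q :* (r :* s)) refl _ _ _ _) ⟩
        ∑[ l < m ] (coefficient j l * B l x - δ j l * (μ * B l x))
          ≈⟨ ∑-minus (λ l → coefficient j l * B l x) (λ l → δ j l * (μ * B l x)) ⟩
        combination (coefficient j) B x - ∑[ l < m ] (δ j l * (μ * B l x))
          ≈⟨ +-cong (expand j x) (-‿cong (∑-δ j (λ l → μ * B l x))) ⟩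
        μ * B j x - μ * B j x
          ≈⟨ -‿inverseʳ _ ⟩
        0# ∎

      diagonal : ∀ l → ∑[ x < n ] (t x l * B l x) ≈ μ
      diagonal l = begin
        coefficient l l                 ≈⟨ x-y≈0⇒x≈y (independent _ (residual l) l) ⟩
        δ l l * μ                       ≈⟨ *-congʳ (δ-refl l) ⟩
        1# * μ                          ≈⟨ *-identityˡ μ ⟩
        μ                               ∎

  module _ {n} (M : Matrix n) where

    power : ℕ → Matrix n
    power zero    x y = δ x y
    power (suc j) x y = (M *ᵥ λ z → power j z y) x

    *ᵥ-assoc : ∀ (N : Matrix n) v x → ∑[ y < n ] ((M *ᵥ λ z → N z y) x * v y) ≈ (M *ᵥ (N *ᵥ v)) x
    *ᵥ-assoc N v x = begin
      ∑[ y < n ] ((∑[ z < n ] (M x z * N z y)) * v y)  ≈⟨ ∑-cong {n} (λ y → *-distribʳ-sum (v y) (λ z → M x z * N z y)) ⟩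
      ∑[ y < n ] ∑[ z < n ] (M x z * N z y * v y)      ≈⟨ ∑-comm {n} {n} (λ y z → M x z * N z y * v y) ⟩
      ∑[ z < n ] ∑[ y < n ] (M x z * N z y * v y)      ≈⟨ ∑-cong {n} (λ z → ∑-cong {n} (λ y → *-assoc _ _ _)) ⟩
      ∑[ z < n ] ∑[ y < n ] (M x z * (N z y * v y))    ≈⟨ ∑-cong {n} (λ z → *-distribˡ-sum (M x z) (λ y → N z y * v y)) ⟨
      ∑[ z < n ] (M x z * (N *ᵥ v) z)                  ∎

    *ᵥ-scale : ∀ a (v : Vector Carrier n) x → (M *ᵥ λ z → a * v z) x ≈ a * (M *ᵥ v) x
    *ᵥ-scale a v x = begin
      ∑[ z < n ] (M x z * (a * v z))      ≈⟨ ∑-cong {n} (λ z → solve 3 (λ p q r → p :* (q :* r) := q :* (p :* r)) refl _ _ _) ⟩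
      ∑[ z < n ] (a * (M x z * v z))      ≈⟨ *-distribˡ-sum {n} a _ ⟨
      a * (M *ᵥ v) x                      ∎

    power-*ᵥ-eigenvector : ∀ {μ v} → Eigenspace M μ v → ∀ j x → (power j *ᵥ v) x ≈ μ ^ j * v x
    power-*ᵥ-eigenvector {μ} {v} Mv≈μv zero    x = trans (∑-δ x v) (sym (*-identityˡ _))
    power-*ᵥ-eigenvector {μ} {v} Mv≈μv (suc j) x = begin
      (power (suc j) *ᵥ v) x          ≈⟨ *ᵥ-assoc (power j) v x ⟩
      (M *ᵥ (power j *ᵥ v)) x         ≈⟨ ∑-cong {n} (λ z → *-congˡ (power-*ᵥ-eigenvector Mv≈μv j z)) ⟩
      (M *ᵥ λ z → μ ^ j * v z) x      ≈⟨ *ᵥ-scale (μ ^ j) v x ⟩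
      μ ^ j * (M *ᵥ v) x              ≈⟨ *-congˡ (Mv≈μv x) ⟩
      μ ^ j * (μ * v x)               ≈⟨ solve 3 (λ p q r → p :* (q :* r) := q :* p :* r) refl _ _ _ ⟩
      μ ^ suc j * v x                 ∎

    Δs-power-*ᵥ-eigenvector : ∀ as {μ v} → Eigenspace M μ v → ∀ x →
      ((λ x y → Δs as (λ j → power j x y) 0) *ᵥ v) x ≈ ∏[ μ - as ] * v x
    Δs-power-*ᵥ-eigenvector as {μ} {v} Mv≈μv x = begin
      ∑[ y < n ] (Δs as (λ j → power j x y) 0 * v y)      ≈⟨ ∑-cong {n} (λ y → trans (*-comm _ _) (sym (Δs-* as (v y) _ 0))) ⟩
      ∑[ y < n ] Δs as (λ j → v y * power j x y) 0        ≈⟨ Δs-∑ {n} as (λ y j → v y * power j x y) 0 ⟨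
      Δs as (λ j → ∑[ y < n ] (v y * power j x y)) 0      ≈⟨ Δs-cong as (λ j → trans (∑-cong {n} (λ y → *-comm _ _)) (power-*ᵥ-eigenvector Mv≈μv j x)) 0 ⟩
      Δs as (λ j → μ ^ j * v x) 0                         ≈⟨ Δs-cong as (λ j → *-comm _ _) 0 ⟩
      Δs as (λ j → v x * μ ^ j) 0                         ≈⟨ Δs-* as (v x) _ 0 ⟩
      v x * Δs as (μ ^_) 0                                ≈⟨ *-congˡ (Δs-power as μ 0) ⟩
      v x * (∏[ μ - as ] * 1#)                            ≈⟨ trans (*-congˡ (*-identityʳ _)) (*-comm _ _) ⟩
      ∏[ μ - as ] * v x                                   ∎

    -- Multiplying ∏ (M - a) by `M` multiplies the polynomial by X, which shifts the sequence by
    -- one.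
    Δs-power-suc : ∀ as x y → (M *ᵥ λ z → Δs as (λ j → power j z y) 0) x ≈ Δs as (λ j → power j x y) 1
    Δs-power-suc as x y = begin
      ∑[ z < n ] (M x z * Δs as (λ j → power j z y) 0)    ≈⟨ ∑-cong {n} (λ z → Δs-* as (M x z) _ 0) ⟨
      ∑[ z < n ] Δs as (λ j → M x z * power j z y) 0      ≈⟨ Δs-∑ {n} as (λ z j → M x z * power j z y) 0 ⟨
      Δs as (λ j → power (suc j) x y) 0                   ≈⟨ Δs-shift as (λ j → power j x y) 0 ⟩
      Δs as (λ j → power j x y) 1                         ∎

    -- The polynomial ∏ (X - a) in M is ∏ (μ - a) times a projection onto the
    -- μ-eigenspace as soon as multiplying it by X - μ gives zero.
    trace-Δs-power : ∀ {μ m} as → HasDimension (Eigenspace M μ) m →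
      (∀ x y → Δs (μ ∷ as) (λ j → power j x y) 0 ≈ 0#) →
      Δs as (λ j → ∑[ x < n ] power j x x) 0 ≈ m ×# 1# * ∏[ μ - as ]
    trace-Δs-power {μ} {m} as (B , isBasis) annihilates = begin
      Δs as (λ j → ∑[ x < n ] power j x x) 0     ≈⟨ Δs-∑ {n} as (λ x j → power j x x) 0 ⟩
      ∑[ x < n ] Δs as (λ j → power j x x) 0
        ≈⟨ trace-multiple-of-projection B isBasis _
             -- For N = ∏ (M - a) the hypothesis says that M N - μ N vanishes, so each column of N
             -- lies in the eigenspace.
             (λ y x → trans (Δs-power-suc as x y) (x-y≈0⇒x≈y (trans (sym (Δ-unfold _ _ 0)) (annihilates x y))))
             (λ v → Δs-power-*ᵥ-eigenvector as) ⟩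
      m ×# 1# * ∏[ μ - as ]                      ∎

  ∏-vanish : ∀ μ as bs → ∏[ μ - (as ++ μ ∷ bs) ] ≈ 0#
  ∏-vanish μ []       bs = trans (*-congʳ (-‿inverseʳ μ)) (zeroˡ _)
  ∏-vanish μ (a ∷ as) bs = trans (*-congˡ (∏-vanish μ as bs)) (zeroʳ _)

  module _ {n} (M : Matrix n) {a b c d} {mᵃ mᵇ mᶜ mᵈ}
           (a#b : a # b) (a#c : a # c) (a#d : a # d) (b#c : b # c) (b#d : b # d) (c#d : c # d)
           (dimᵃ : HasDimension (Eigenspace M a) mᵃ) (dimᵇ : HasDimension (Eigenspace M b) mᵇ)
           (dimᶜ : HasDimension (Eigenspace M c) mᶜ) (dimᵈ : HasDimension (Eigenspace M d) mᵈ)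
           (annihilates : ∀ x y → Δs (a ∷ b ∷ c ∷ d ∷ []) (λ j → power M j x y) 0 ≈ 0#) where

    private
      traces : ℕ → Carrier
      traces j = ∑[ x < n ] power M j x x

      A B C D : Carrier
      A = mᵃ ×# 1#
      B = mᵇ ×# 1#
      C = mᶜ ×# 1#
      D = mᵈ ×# 1#

    powerSum : ℕ → Carrier
    powerSum j = mᵃ ×# 1# * a ^ j + mᵇ ×# 1# * b ^ j + mᶜ ×# 1# * c ^ j + mᵈ ×# 1# * d ^ j

    private
      Δs-term : ∀ as N μ → Δs as (λ j → N * μ ^ j) 0 ≈ N * ∏[ μ - as ]
      Δs-term as N μ = trans (Δs-* as N (μ ^_) 0) (*-congˡ (trans (Δs-power as μ 0) (*-identityʳ _)))

      Δs-powerSum : ∀ as → Δs as powerSum 0 ≈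
        A * ∏[ a - as ] + B * ∏[ b - as ] + C * ∏[ c - as ] + D * ∏[ d - as ]
      Δs-powerSum as =
        trans (Δs-+ as _ _ 0) (+-cong
        (trans (Δs-+ as _ _ 0) (+-cong
        (trans (Δs-+ as _ _ 0) (+-cong (Δs-term as A a) (Δs-term as B b)))
        (Δs-term as C c))) (Δs-term as D d))

      -- Written as a sum with a scalar multiple so that `Δs-+` and `Δs-*` apply.
      difference : ℕ → Carrier
      difference j = traces j + - 1# * powerSum j

      difference-vanishes : ∀ as → Δs as traces 0 ≈ Δs as powerSum 0 → Δs as difference 0 ≈ 0#
      difference-vanishes as eq = begin
        Δs as difference 0                                 ≈⟨ Δs-+ as _ _ 0 ⟩
        Δs as traces 0 + Δs as (λ j → - 1# * powerSum j) 0 ≈⟨ +-cong eq (Δs-* as _ _ 0) ⟩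
        Δs as powerSum 0 + - 1# * Δs as powerSum 0         ≈⟨ +-congˡ (trans (sym (-‿distribˡ-* _ _)) (-‿cong (*-identityˡ _))) ⟩
        Δs as powerSum 0 - Δs as powerSum 0                ≈⟨ -‿inverseʳ _ ⟩
        0#                                                 ∎

      swap : ∀ a b as σ → Δs (a ∷ b ∷ as) σ 0 ≈ 0# → Δs (b ∷ a ∷ as) σ 0 ≈ 0#
      swap a b as σ = trans (Δ-comm b a (Δs as σ) 0)

      1st : ∀ {x y z w} → y ≈ 0# → z ≈ 0# → w ≈ 0# → x ≈ x + y + z + w
      1st {x} y z w = sym (trans (+-cong (+-cong (+-congˡ y) z) w)
        (solve 1 (λ x → x :+ con (+ 0) :+ con (+ 0) :+ con (+ 0) := x) refl x))

      2nd : ∀ {x y z w} → y ≈ 0# → z ≈ 0# → w ≈ 0# → x ≈ y + x + z + w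
      2nd {x} y z w = sym (trans (+-cong (+-cong (+-congʳ y) z) w)
        (solve 1 (λ x → con (+ 0) :+ x :+ con (+ 0) :+ con (+ 0) := x) refl x))

      3rd : ∀ {x y z w} → y ≈ 0# → z ≈ 0# → w ≈ 0# → x ≈ y + z + x + w
      3rd {x} y z w = sym (trans (+-cong (+-congʳ (+-cong y z)) w)
        (solve 1 (λ x → con (+ 0) :+ con (+ 0) :+ x :+ con (+ 0) := x) refl x))

      4th : ∀ {x y z w} → y ≈ 0# → z ≈ 0# → w ≈ 0# → x ≈ y + z + w + x
      4th {x} y z w = sym (trans (+-congʳ (+-cong (+-cong y z) w))
        (solve 1 (λ x → con (+ 0) :+ con (+ 0) :+ con (+ 0) :+ x := x) refl x))

      *-vanish : ∀ N μ as bs → N * ∏[ μ - (as ++ μ ∷ bs) ] ≈ 0#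
      *-vanish N μ as bs = trans (*-congˡ (∏-vanish μ as bs)) (zeroʳ N)

      match : ∀ as {N μ} → Δs as traces 0 ≈ N * ∏[ μ - as ] →
              N * ∏[ μ - as ] ≈ A * ∏[ a - as ] + B * ∏[ b - as ] + C * ∏[ c - as ] + D * ∏[ d - as ] →
              Δs as difference 0 ≈ 0#
      match as p q = difference-vanishes as (trans p (trans q (sym (Δs-powerSum as))))

      entry : Fin n → Fin n → ℕ → Carrier
      entry x y j = power M j x y

      -- On the product over the other three eigenvalues only the term of `a` survives in the power
      -- sum, and `trace-Δs-power` gives the same value for the trace. In the three companion cases
      -- the omitted eigenvalue is first moved to the front of the annihilating product.
      bcd : Δs (b ∷ c ∷ d ∷ []) difference 0 ≈ 0#
      bcd = match (b ∷ c ∷ d ∷ []) {A} {a} (trace-Δs-power M (b ∷ c ∷ d ∷ []) dimᵃ annihilates)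
        (1st (*-vanish B b [] (c ∷ d ∷ [])) (*-vanish C c (b ∷ []) (d ∷ [])) (*-vanish D d (b ∷ c ∷ []) []))

      acd : Δs (a ∷ c ∷ d ∷ []) difference 0 ≈ 0#
      acd = match (a ∷ c ∷ d ∷ []) {B} {b} (trace-Δs-power M (a ∷ c ∷ d ∷ []) dimᵇ λ x y →
          swap a b (c ∷ d ∷ []) (entry x y) (annihilates x y))
        (2nd (*-vanish A a [] (c ∷ d ∷ [])) (*-vanish C c (a ∷ []) (d ∷ [])) (*-vanish D d (a ∷ c ∷ []) []))

      abd : Δs (a ∷ b ∷ d ∷ []) difference 0 ≈ 0#
      abd = match (a ∷ b ∷ d ∷ []) {C} {c} (trace-Δs-power M (a ∷ b ∷ d ∷ []) dimᶜ λ x y →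
          swap a c (b ∷ d ∷ []) (entry x y)
            (trans (Δ-cong a (Δ-comm c b (Δ d (entry x y))) 0) (annihilates x y)))
        (3rd (*-vanish A a [] (b ∷ d ∷ [])) (*-vanish B b (a ∷ []) (d ∷ [])) (*-vanish D d (a ∷ b ∷ []) []))

      abc : Δs (a ∷ b ∷ c ∷ []) difference 0 ≈ 0#
      abc = match (a ∷ b ∷ c ∷ []) {D} {d} (trace-Δs-power M (a ∷ b ∷ c ∷ []) dimᵈ λ x y →
          swap a d (b ∷ c ∷ []) (entry x y)
            (trans (Δ-cong a (Δ-comm d b (Δ c (entry x y))) 0)
            (trans (Δ-cong a (Δ-cong b (Δ-comm d c (entry x y))) 0) (annihilates x y))))
        (4th (*-vanish A a [] (b ∷ c ∷ [])) (*-vanish B b (a ∷ []) (c ∷ [])) (*-vanish C c (a ∷ b ∷ []) []))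

      equal : ∀ {j} → difference j ≈ 0# → traces j ≈ powerSum j
      equal {j} eq = begin
        traces j                                        ≈⟨ solve 3 (λ u v w → u := u :+ :- v :* w :+ v :* w) refl (traces j) 1# (powerSum j) ⟩
        difference j + 1# * powerSum j                  ≈⟨ +-cong eq (*-identityˡ _) ⟩
        0# + powerSum j                                 ≈⟨ +-identityˡ _ ⟩
        powerSum j                                      ∎

    traces≈powerSums : traces 0 ≈ powerSum 0 × traces 1 ≈ powerSum 1 × traces 2 ≈ powerSum 2
    traces≈powerSums = equal {0} (proj₁ vanish) , equal {1} (proj₁ (proj₂ vanish)) , equal {2} (proj₂ (proj₂ vanish))
      where
      vanish : difference 0 ≈ 0# × difference 1 ≈ 0# × difference 2 ≈ 0#
      vanish = cubics-span {σ = difference} a#b a#c a#d b#c b#d c#d bcd acd abd abc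

  -- Indicator functions and counting

  χ : ∀ {n} → Subset n → Fin n → Carrier
  χ S z = if lookup S z then 1# else 0#

  χ-∈ : ∀ {n} {S : Subset n} {z} → z ∈ S → χ S z ≈ 1#
  χ-∈ here        = refl
  χ-∈ (there z∈S) = χ-∈ z∈S

  χ-∉ : ∀ {n} {S : Subset n} {z} → z ∉ S → χ S z ≈ 0#
  χ-∉ {S = true  ∷ S} {zero}  z∉S = contradiction here z∉S
  χ-∉ {S = false ∷ S} {zero}  z∉S = refl
  χ-∉ {S = _     ∷ S} {suc z} z∉S = χ-∉ {S = S} λ z∈S → z∉S (there z∈S)

  ∑-χ : ∀ {n} (S : Subset n) → ∑[ z < n ] χ S z ≈ ∣ S ∣ ×# 1#
  ∑-χ []          = refl
  ∑-χ (true  ∷ S) = +-congˡ (∑-χ S)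
  ∑-χ (false ∷ S) = trans (+-identityˡ _) (∑-χ S)

  -- Used for nonnegativity: an expression in the parameters that equals such a sum is a natural
  -- number. This is applied to a₁ and to p³₃₃.
  ∑-indicator : ∀ {n} (f : Fin n → Carrier) → (∀ z → f z ≈ 0# ⊎ f z ≈ 1#) →
                ∃[ N ] ∑[ z < n ] f z ≈ N ×# 1#
  ∑-indicator {zero}  f f≈0∨1 = 0 , refl
  ∑-indicator {suc n} f f≈0∨1 with ∑-indicator (λ z → f (suc z)) (λ z → f≈0∨1 (suc z)) | f≈0∨1 zero
  ... | N , eq | inj₁ f0≈0 = N , trans (+-cong f0≈0 eq) (+-identityˡ _)
  ... | N , eq | inj₂ f0≈1 = suc N , +-cong f0≈1 eq

  0∨1 : ∀ {x y} → x ≈ 0# ⊎ x ≈ 1# → y ≈ 0# ⊎ y ≈ 1# → x * y ≈ 0# ⊎ x * y ≈ 1#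
  0∨1 (inj₁ x≈0) _          = inj₁ (trans (*-congʳ x≈0) (zeroˡ _))
  0∨1 (inj₂ x≈1) (inj₁ y≈0) = inj₁ (trans (*-congˡ y≈0) (zeroʳ _))
  0∨1 (inj₂ x≈1) (inj₂ y≈1) = inj₂ (trans (*-cong x≈1 y≈1) (*-identityʳ 1#))

  -- The adjacency matrix and the distance matrices

  module _ (Γ : DistanceRegularGraph 3) where

    open DistanceRegular₃ Γ renaming (sym to ∼-sym)

    A : Matrix order
    A = adjacencyMatrix graph

    A-∼ : ∀ {y z} → y ∼ z → A y z ≈ 1#
    A-∼ {y} {z} y∼z = reflexive (≡.cong (if_then 1# else 0#) (dec-true (y ∼? z) y∼z))

    A-≁ : ∀ {y z} → ¬ y ∼ z → A y z ≈ 0#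
    A-≁ {y} {z} y≁z = reflexive (≡.cong (if_then 1# else 0#) (dec-false (y ∼? z) y≁z))

    A-symmetric : ∀ y z → A y z ≈ A z y
    A-symmetric y z with z ∼? y
    ... | yes z∼y = A-∼ (∼-sym z∼y)
    ... | no  z≁y = A-≁ λ y∼z → z≁y (∼-sym y∼z)

    A-0∨1 : ∀ y z → A y z ≈ 0# ⊎ A y z ≈ 1#
    A-0∨1 y z with y ∼? z
    ... | yes _ = inj₂ refl
    ... | no  _ = inj₁ refl

    -- All neighbours of `y` are given the value at distance i, and those in the two counted sets
    -- are then corrected; neighbours at the same distance need no count of their own. The values at
    -- `ℕ.pred 0` for i = 0 and at `suc 3` for i = 3 are mere defaults, multiplied by `c[ 0F ]` and
    -- `b[ 3F ]`, which vanish.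
    A-*ᵥ-radial : ∀ i {x y} → Distance graph x y (toℕ i) → (f : ℕ → Carrier) →
      (A *ᵥ λ z → f (dist x z)) y ≈
        b[ 0F ] ×# 1# * f (toℕ i) + c[ i ] ×# 1# * (f (ℕ.pred (toℕ i)) - f (toℕ i))
                                  + b[ i ] ×# 1# * (f (suc (toℕ i)) - f (toℕ i))
    A-*ᵥ-radial i {x} {y} dxy f
      with S , S⇔ , ∣S∣ ← b-count 0F (Distance-refl y)
         | C , C⇔ , ∣C∣ ← c-count i dxy
         | B , B⇔ , ∣B∣ ← b-count i dxy = begin
      ∑[ z < order ] (A y z * f (dist x z))                           ≈⟨ ∑-cong {order} pointwise ⟩
      ∑[ z < order ] (χ S z * u + χ C z * v + χ B z * w)              ≈⟨ ∑-distrib-+ {order} (λ z → χ S z * u + χ C z * v) _ ⟩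
      ∑[ z < order ] (χ S z * u + χ C z * v) + ∑[ z < order ] (χ B z * w)
        ≈⟨ +-congʳ (∑-distrib-+ {order} (λ z → χ S z * u) _) ⟩
      ∑[ z < order ] (χ S z * u) + ∑[ z < order ] (χ C z * v) + ∑[ z < order ] (χ B z * w)
        ≈⟨ +-cong (+-cong (total S u ∣S∣) (total C v ∣C∣)) (total B w ∣B∣) ⟩
      b[ 0F ] ×# 1# * u + c[ i ] ×# 1# * v + b[ i ] ×# 1# * w         ∎
      where
      d = toℕ i
      u v w : Carrier
      u = f d
      v = f (ℕ.pred d) - f d
      w = f (suc d) - f d

      total : ∀ (S : Subset order) u {N} → ∣ S ∣ ≡ N → ∑[ z < order ] (χ S z * u) ≈ N ×# 1# * u
      total S u ≡.refl = trans (sym (*-distribʳ-sum {order} u (χ S))) (*-congʳ (∑-χ S))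

      1s : ∀ {p q r} {p′ q′ r′ : Carrier} → p ≈ p′ → q ≈ q′ → r ≈ r′ →
           p * u + q * v + r * w ≈ p′ * u + q′ * v + r′ * w
      1s p q r = +-cong (+-cong (*-congʳ p) (*-congʳ q)) (*-congʳ r)

      pointwise : ∀ z → A y z * f (dist x z) ≈ χ S z * u + χ C z * v + χ B z * w
      pointwise z with y ∼? z
      ... | no y≁z = begin
        0# * f (dist x z)                   ≈⟨ zeroˡ _ ⟩
        0#                                  ≈⟨ solve 3 (λ u v w → con (+ 0) := con (+ 0) :* u :+ con (+ 0) :* v :+ con (+ 0) :* w) refl u v w ⟩
        0# * u + 0# * v + 0# * w            ≈⟨ 1s (χ-∉ λ m → y≁z (proj₁ (Equivalence.to (S⇔ z) m)))
                                                  (χ-∉ λ m → y≁z (proj₁ (Equivalence.to (C⇔ z) m)))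
                                                  (χ-∉ λ m → y≁z (proj₁ (Equivalence.to (B⇔ z) m))) ⟨
        χ S z * u + χ C z * v + χ B z * w   ∎
      ... | yes y∼z with z∈S ← Equivalence.from (S⇔ z) (y∼z , ∼⇒Distance-1 y∼z)
                    | dxz ← Distance-dist x z
                    | Distance-neighbours y∼z dxy (Distance-dist x z)
      ...   | inj₁ 1+e≡d = begin
        1# * f (dist x z)                   ≡⟨ ≡.cong (λ j → 1# * f j) (≡.cong ℕ.pred 1+e≡d) ⟩
        1# * f (ℕ.pred d)                   ≈⟨ solve 4 (λ o p u w → o :* p := o :* u :+ o :* (p :- u) :+ con (+ 0) :* w) refl 1# _ u w ⟩
        1# * u + 1# * v + 0# * w            ≈⟨ 1s (χ-∈ z∈S) (χ-∈ (Equivalence.from (C⇔ z) (y∼z , _ , 1+e≡d , dxz)))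
                                                  -- A vertex in both sets would have two distances
                                                  -- from `x` that differ by two.
                                                  (χ-∉ λ m → ℕ.m≢1+m+n _ {1} (≡.trans (Distance-unique dxz (proj₂ (Equivalence.to (B⇔ z) m)))
                                                    (≡.trans (≡.cong suc (≡.sym 1+e≡d)) (≡.cong suc (ℕ.+-comm 1 _))))) ⟨
        χ S z * u + χ C z * v + χ B z * w   ∎
      ...   | inj₂ (inj₁ e≡d) = begin
        1# * f (dist x z)                   ≡⟨ ≡.cong (λ j → 1# * f j) e≡d ⟩
        1# * u                              ≈⟨ solve 4 (λ o u v w → o :* u := o :* u :+ con (+ 0) :* v :+ con (+ 0) :* w) refl 1# u v w ⟩
        1# * u + 0# * v + 0# * w            ≈⟨ 1s (χ-∈ z∈S)
                                                  (χ-∉ λ m → let j , 1+j≡d , dxz′ = proj₂ (Equivalence.to (C⇔ z) m) in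
                                                    ℕ.1+n≢n (≡.trans 1+j≡d (≡.trans (≡.sym e≡d) (Distance-unique dxz dxz′))))
                                                  (χ-∉ λ m → ℕ.1+n≢n (≡.trans (Distance-unique (proj₂ (Equivalence.to (B⇔ z) m)) dxz) e≡d)) ⟨
        χ S z * u + χ C z * v + χ B z * w   ∎
      ...   | inj₂ (inj₂ e≡1+d) = begin
        1# * f (dist x z)                   ≡⟨ ≡.cong (λ j → 1# * f j) e≡1+d ⟩
        1# * f (suc d)                      ≈⟨ solve 4 (λ o p u v → o :* p := o :* u :+ con (+ 0) :* v :+ o :* (p :- u)) refl 1# _ u v ⟩
        1# * u + 0# * v + 1# * w            ≈⟨ 1s (χ-∈ z∈S)
                                                  (χ-∉ λ m → let j , 1+j≡d , dxz′ = proj₂ (Equivalence.to (C⇔ z) m) in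
                                                    ℕ.m≢1+m+n j {1} (≡.trans (Distance-unique dxz′ dxz) (≡.trans e≡1+d
                                                      (≡.cong suc (≡.trans (≡.sym 1+j≡d) (ℕ.+-comm 1 j))))))
                                                  (χ-∈ (Equivalence.from (B⇔ z) (y∼z , ≡.subst (Distance graph x z) e≡1+d dxz))) ⟨
        χ S z * u + χ C z * v + χ B z * w   ∎

    -- Kronecker's delta: `e i (dist x y)` is an entry of the distance-i matrix Aᵢ. The diagonal
    -- value `1 ×# 1#` is the form that the solver's `con (+ 1)` denotes.
    e : ℕ → ℕ → Carrier
    e zero    zero    = 1 ×# 1#
    e zero    (suc _) = 0#
    e (suc i) zero    = 0#
    e (suc i) (suc j) = e i j

    e-off-diagonal : ∀ {i j} → i ≢ j → e i j ≈ 0#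
    e-off-diagonal {zero}  {zero}  0≢0 = contradiction ≡.refl 0≢0
    e-off-diagonal {zero}  {suc j} i≢j = refl
    e-off-diagonal {suc i} {zero}  i≢j = refl
    e-off-diagonal {suc i} {suc j} i≢j = e-off-diagonal {i} {j} λ i≡j → i≢j (≡.cong suc i≡j)

    e-0∨1 : ∀ i j → e i j ≈ 0# ⊎ e i j ≈ 1#
    e-0∨1 zero    zero    = inj₂ (+-identityʳ 1#)
    e-0∨1 zero    (suc j) = inj₁ refl
    e-0∨1 (suc i) zero    = inj₁ refl
    e-0∨1 (suc i) (suc j) = e-0∨1 i j

    δ≈e₀ : ∀ x y → δ y x ≈ e 0 (dist x y)
    δ≈e₀ x y with y Fin.≟ x
    ... | yes ≡.refl = sym (trans (reflexive (≡.cong (e 0) (dist-≡ (Distance-refl y)))) (+-identityʳ 1#))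
    ... | no  y≢x    = sym (e-off-diagonal λ 0≡d → y≢x (≡.sym (Distance-0⇒≡ (≡.subst (Distance graph x y) (≡.sym 0≡d) (Distance-dist x y)))))

    e-partition : ∀ {d} → d ℕ.≤ 3 → e 0 d + e 1 d + e 2 d + e 3 d ≈ 1#
    e-partition {0} _ = trans (solve 0 (con (+ 1) :+ con (+ 0) :+ con (+ 0) :+ con (+ 0) := con (+ 1)) refl) (+-identityʳ 1#)
    e-partition {1} _ = trans (solve 0 (con (+ 0) :+ con (+ 1) :+ con (+ 0) :+ con (+ 0) := con (+ 1)) refl) (+-identityʳ 1#)
    e-partition {2} _ = trans (solve 0 (con (+ 0) :+ con (+ 0) :+ con (+ 1) :+ con (+ 0) := con (+ 1)) refl) (+-identityʳ 1#)
    e-partition {3} _ = trans (solve 0 (con (+ 0) :+ con (+ 0) :+ con (+ 0) :+ con (+ 1) := con (+ 1)) refl) (+-identityʳ 1#)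
    e-partition {suc (suc (suc (suc _)))} (s≤s (s≤s (s≤s ())))

    -- The element ∑ f(i) Aᵢ of the Bose-Mesner algebra, applied to `v`.
    ⟪_,_⟫ : (ℕ → Carrier) → Vector Carrier order → Fin order → Carrier
    ⟪ f , v ⟫ y = ∑[ z < order ] (f (dist y z) * v z)

    ⟪⟫-cong : ∀ {f g} v y → (∀ d → f d ≈ g d) → ⟪ f , v ⟫ y ≈ ⟪ g , v ⟫ y
    ⟪⟫-cong v y f≈g = ∑-cong {order} λ z → *-congʳ (f≈g (dist y z))

    ⟪⟫-congʳ : ∀ {v w} f y → (∀ z → v z ≈ w z) → ⟪ f , v ⟫ y ≈ ⟪ f , w ⟫ y
    ⟪⟫-congʳ f y v≈w = ∑-cong {order} λ z → *-congˡ (v≈w z)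

    ⟪⟫-* : ∀ a f v y → ⟪ (λ d → a * f d) , v ⟫ y ≈ a * ⟪ f , v ⟫ y
    ⟪⟫-* a f v y = trans (∑-cong {order} λ z → *-assoc a (f (dist y z)) (v z)) (sym (*-distribˡ-sum {order} a _))

    ⟪⟫-*ʳ : ∀ a f v y → ⟪ f , (λ z → a * v z) ⟫ y ≈ a * ⟪ f , v ⟫ y
    ⟪⟫-*ʳ a f v y = trans (∑-cong {order} λ z → solve 3 (λ a f v → f :* (a :* v) := a :* (f :* v)) refl a (f (dist y z)) (v z))
      (sym (*-distribˡ-sum {order} a _))

    ⟪⟫-+ : ∀ f g v y → ⟪ (λ d → f d + g d) , v ⟫ y ≈ ⟪ f , v ⟫ y + ⟪ g , v ⟫ y
    ⟪⟫-+ f g v y = trans (∑-cong {order} λ z → distribʳ (v z) (f (dist y z)) (g (dist y z))) (∑-distrib-+ {order} _ _)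

    ⟪e₀⟫ : ∀ v y → ⟪ e 0 , v ⟫ y ≈ v y
    ⟪e₀⟫ v y = begin
      ∑[ z < order ] (e 0 (dist y z) * v z)    ≈⟨ ∑-cong {order} (λ z → *-congʳ (trans (sym (δ≈e₀ y z)) (δ-symmetric z y))) ⟩
      ∑[ z < order ] (δ y z * v z)             ≈⟨ ∑-δ y v ⟩
      v y                                      ∎

    ⟪⟫-combination₃ : ∀ p f q g r h v y → ⟪ (λ d → p * f d + q * g d + r * h d) , v ⟫ y ≈
                      p * ⟪ f , v ⟫ y + q * ⟪ g , v ⟫ y + r * ⟪ h , v ⟫ y
    ⟪⟫-combination₃ p f q g r h v y =
      trans (⟪⟫-+ (λ d → p * f d + q * g d) (λ d → r * h d) v y) (+-cong
      (trans (⟪⟫-+ (λ d → p * f d) (λ d → q * g d) v y) (+-cong (⟪⟫-* p f v y) (⟪⟫-* q g v y)))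
      (⟪⟫-* r h v y))

    -- The intersection matrix

    -- The intersection numbers are arbitrary field elements equal to the counts, since the module
    -- is opened twice: with the raw counts in order to derive k = b s, and then with expressions in
    -- b and s.
    module Radial
      {k : Carrier}  (k≈  : b[ 0F ] ×# 1# ≈ k)
      {b₁ : Carrier} (b₁≈ : b[ 1F ] ×# 1# ≈ b₁)
      {c₂ : Carrier} (c₂≈ : c[ 2F ] ×# 1# ≈ c₂)
      {b₂ : Carrier} (b₂≈ : b[ 2F ] ×# 1# ≈ b₂)
      {c₃ : Carrier} (c₃≈ : c[ 3F ] ×# 1# ≈ c₃)
      {a₁ : Carrier} (a₁≈ : k - b₁ - 1 ×# 1# ≈ a₁)
      {a₂ : Carrier} (a₂≈ : k - b₂ - c₂ ≈ a₂)
      {a₃ : Carrier} (a₃≈ : k - c₃ ≈ a₃)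
      where

      -- The adjacency matrix on functions of the distance to a fixed vertex.
      T : (ℕ → Carrier) → ℕ → Carrier
      T f 0 = k * f 1
      T f 1 = f 0 + a₁ * f 1 + b₁ * f 2
      T f 2 = c₂ * f 1 + a₂ * f 2 + b₂ * f 3
      T f 3 = c₃ * f 2 + a₃ * f 3
      T f (suc (suc (suc (suc _)))) = 0#

      A-radial-at : ∀ f {x y} d → d ℕ.≤ 3 → Distance graph x y d → (A *ᵥ λ z → f (dist x z)) y ≈ T f d
      A-radial-at f {x} {y} 0 _ dxy = begin
        (A *ᵥ λ z → f (dist x z)) y    ≈⟨ A-*ᵥ-radial 0F dxy f ⟩
        _                              ≈⟨ +-cong (+-cong (*-congʳ k≈) (*-congʳ (reflexive (≡.cong (_×# 1#) c₀≡0)))) (*-congʳ k≈) ⟩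
        _                              ≈⟨ solve 3 (λ k u w → k :* u :+ con (+ 0) :* (u :- u) :+ k :* (w :- u) := k :* w) refl k (f 0) (f 1) ⟩
        k * f 1                        ∎
      A-radial-at f {x} {y} 1 _ dxy = begin
        (A *ᵥ λ z → f (dist x z)) y    ≈⟨ A-*ᵥ-radial 1F dxy f ⟩
        _                              ≈⟨ +-cong (+-cong (*-congʳ k≈) (*-congʳ (reflexive (≡.cong (_×# 1#) c₁≡1)))) (*-congʳ b₁≈) ⟩
        _                              ≈⟨ solve 5 (λ k b u v w → k :* v :+ con (+ 1) :* (u :- v) :+ b :* (w :- v)
                                                              := u :+ (k :- b :- con (+ 1)) :* v :+ b :* w) refl k b₁ (f 0) (f 1) (f 2) ⟩
        _                              ≈⟨ +-congʳ (+-congˡ (*-congʳ a₁≈)) ⟩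
        T f 1                          ∎
      A-radial-at f {x} {y} 2 _ dxy = begin
        (A *ᵥ λ z → f (dist x z)) y    ≈⟨ A-*ᵥ-radial 2F dxy f ⟩
        _                              ≈⟨ +-cong (+-cong (*-congʳ k≈) (*-congʳ c₂≈)) (*-congʳ b₂≈) ⟩
        _                              ≈⟨ solve 6 (λ k c b u v w → k :* v :+ c :* (u :- v) :+ b :* (w :- v)
                                                              := c :* u :+ (k :- b :- c) :* v :+ b :* w) refl k c₂ b₂ (f 1) (f 2) (f 3) ⟩
        _                              ≈⟨ +-congʳ (+-congˡ (*-congʳ a₂≈)) ⟩
        T f 2                          ∎
      A-radial-at f {x} {y} 3 _ dxy = begin
        (A *ᵥ λ z → f (dist x z)) y    ≈⟨ A-*ᵥ-radial 3F dxy f ⟩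
        _                              ≈⟨ +-cong (+-cong (*-congʳ k≈) (*-congʳ c₃≈)) (*-congʳ (reflexive (≡.cong (_×# 1#) b₃≡0))) ⟩
        _                              ≈⟨ solve 5 (λ k c u v w → k :* v :+ c :* (u :- v) :+ con (+ 0) :* (w :- v)
                                                              := c :* u :+ (k :- c) :* v) refl k c₃ (f 2) (f 3) (f 4) ⟩
        _                              ≈⟨ +-congˡ (*-congʳ a₃≈) ⟩
        T f 3                          ∎
      A-radial-at f (suc (suc (suc (suc _)))) (s≤s (s≤s (s≤s ())))

      A-radial : ∀ f x y → (A *ᵥ λ z → f (dist x z)) y ≈ T f (dist x y)
      A-radial f x y = A-radial-at f (dist x y) (dist≤3 x y) (Distance-dist x y)

      A-rows : ∀ w y → (A *ᵥ λ _ → w) y ≈ k * w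
      A-rows w y = A-radial-at (λ _ → w) 0 z≤n (Distance-refl y)

      T^ : ℕ → (ℕ → Carrier) → ℕ → Carrier
      T^ zero    f = f
      T^ (suc j) f = T (T^ j f)

      power-radial : ∀ j x y → power A j y x ≈ T^ j (e 0) (dist x y)
      power-radial zero    x y = δ≈e₀ x y
      power-radial (suc j) x y = begin
        ∑[ z < order ] (A y z * power A j z x)              ≈⟨ ∑-cong {order} (λ z → *-congˡ (power-radial j x z)) ⟩
        ∑[ z < order ] (A y z * T^ j (e 0) (dist x z))      ≈⟨ A-radial (T^ j (e 0)) x y ⟩
        T (T^ j (e 0)) (dist x y)                           ∎

      -- A row of ∑ f(i) Aᵢ is a function of the distance to `y`, on which `A` acts as `T`; the
      -- symmetry of `A` moves this action to `v`.
      T-adjoint : ∀ f v y → ⟪ T f , v ⟫ y ≈ ⟪ f , A *ᵥ v ⟫ y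
      T-adjoint f v y = begin
        ∑[ z < order ] (T f (dist y z) * v z)                                   ≈⟨ ∑-cong {order} (λ z → *-congʳ (A-radial f y z)) ⟨
        ∑[ z < order ] ((∑[ w < order ] (A z w * f (dist y w))) * v z)          ≈⟨ ∑-cong {order} (λ z → *-distribʳ-sum (v z) (λ w → A z w * f (dist y w))) ⟩
        ∑[ z < order ] ∑[ w < order ] (A z w * f (dist y w) * v z)              ≈⟨ ∑-comm {order} {order} (λ z w → A z w * f (dist y w) * v z) ⟩
        ∑[ w < order ] ∑[ z < order ] (A z w * f (dist y w) * v z)              ≈⟨ ∑-cong {order} (λ w → ∑-cong {order} (λ z →
                                                                                     trans (*-congʳ (*-congʳ (A-symmetric z w)))
                                                                                     (solve 3 (λ p q r → p :* q :* r := q :* (p :* r)) refl (A w z) (f (dist y w)) (v z)))) ⟩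
        ∑[ w < order ] ∑[ z < order ] (f (dist y w) * (A w z * v z))            ≈⟨ ∑-cong {order} (λ w → *-distribˡ-sum (f (dist y w)) (λ z → A w z * v z)) ⟨
        ∑[ w < order ] (f (dist y w) * (A *ᵥ v) w)                              ∎

      -- Together with its three successors this is the recurrence A Aⱼ = bⱼ₋₁ Aⱼ₋₁ + aⱼ Aⱼ + cⱼ₊₁
      -- Aⱼ₊₁.
      T-e₀ : ∀ d → T (e 0) d ≈ e 1 d
      T-e₀ 0 = zeroʳ k
      T-e₀ 1 = solve 2 (λ a b → con (+ 1) :+ a :* con (+ 0) :+ b :* con (+ 0) := con (+ 1)) refl a₁ b₁
      T-e₀ 2 = solve 3 (λ a b c → c :* con (+ 0) :+ a :* con (+ 0) :+ b :* con (+ 0) := con (+ 0)) refl a₂ b₂ c₂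
      T-e₀ 3 = solve 2 (λ a c → c :* con (+ 0) :+ a :* con (+ 0) := con (+ 0)) refl a₃ c₃
      T-e₀ (suc (suc (suc (suc _)))) = refl

      T-e₁ : ∀ d → T (e 1) d ≈ k * e 0 d + a₁ * e 1 d + c₂ * e 2 d
      T-e₁ 0 = solve 3 (λ k a c → k :* con (+ 1) := k :* con (+ 1) :+ a :* con (+ 0) :+ c :* con (+ 0)) refl k a₁ c₂
      T-e₁ 1 = solve 4 (λ k a c b → con (+ 0) :+ a :* con (+ 1) :+ b :* con (+ 0) := k :* con (+ 0) :+ a :* con (+ 1) :+ c :* con (+ 0)) refl k a₁ c₂ b₁
      T-e₁ 2 = solve 5 (λ k a c b a′ → c :* con (+ 1) :+ a′ :* con (+ 0) :+ b :* con (+ 0) := k :* con (+ 0) :+ a :* con (+ 0) :+ c :* con (+ 1)) refl k a₁ c₂ b₂ a₂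
      T-e₁ 3 = solve 5 (λ k a c c′ a′ → c′ :* con (+ 0) :+ a′ :* con (+ 0) := k :* con (+ 0) :+ a :* con (+ 0) :+ c :* con (+ 0)) refl k a₁ c₂ c₃ a₃
      T-e₁ (suc (suc (suc (suc _)))) = solve 3 (λ k a c → con (+ 0) := k :* con (+ 0) :+ a :* con (+ 0) :+ c :* con (+ 0)) refl k a₁ c₂

      T-e₂ : ∀ d → T (e 2) d ≈ b₁ * e 1 d + a₂ * e 2 d + c₃ * e 3 d
      T-e₂ 0 = solve 4 (λ k b a c → k :* con (+ 0) := b :* con (+ 0) :+ a :* con (+ 0) :+ c :* con (+ 0)) refl k b₁ a₂ c₃
      T-e₂ 1 = solve 4 (λ b a c a′ → con (+ 0) :+ a′ :* con (+ 0) :+ b :* con (+ 1) := b :* con (+ 1) :+ a :* con (+ 0) :+ c :* con (+ 0)) refl b₁ a₂ c₃ a₁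
      T-e₂ 2 = solve 5 (λ b a c c′ b′ → c′ :* con (+ 0) :+ a :* con (+ 1) :+ b′ :* con (+ 0) := b :* con (+ 0) :+ a :* con (+ 1) :+ c :* con (+ 0)) refl b₁ a₂ c₃ c₂ b₂
      T-e₂ 3 = solve 4 (λ b a c a′ → c :* con (+ 1) :+ a′ :* con (+ 0) := b :* con (+ 0) :+ a :* con (+ 0) :+ c :* con (+ 1)) refl b₁ a₂ c₃ a₃
      T-e₂ (suc (suc (suc (suc _)))) = solve 3 (λ k a c → con (+ 0) := k :* con (+ 0) :+ a :* con (+ 0) :+ c :* con (+ 0)) refl b₁ a₂ c₃

      T-e₃ : ∀ d → T (e 3) d ≈ b₂ * e 2 d + a₃ * e 3 d
      T-e₃ 0 = solve 3 (λ k b a → k :* con (+ 0) := b :* con (+ 0) :+ a :* con (+ 0)) refl k b₂ a₃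
      T-e₃ 1 = solve 4 (λ b a b′ a′ → con (+ 0) :+ a′ :* con (+ 0) :+ b′ :* con (+ 0) := b :* con (+ 0) :+ a :* con (+ 0)) refl b₂ a₃ b₁ a₁
      T-e₃ 2 = solve 4 (λ b a c a′ → c :* con (+ 0) :+ a′ :* con (+ 0) :+ b :* con (+ 1) := b :* con (+ 1) :+ a :* con (+ 0)) refl b₂ a₃ c₂ a₂
      T-e₃ 3 = solve 3 (λ b a c → c :* con (+ 0) :+ a :* con (+ 1) := b :* con (+ 0) :+ a :* con (+ 1)) refl b₂ a₃ c₃
      T-e₃ (suc (suc (suc (suc _)))) = solve 2 (λ k a → con (+ 0) := k :* con (+ 0) :+ a :* con (+ 0)) refl b₂ a₃

      T-cong : ∀ {f g} → (∀ d → f d ≈ g d) → ∀ d → T f d ≈ T g d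
      T-cong f≈g 0 = *-congˡ (f≈g 1)
      T-cong f≈g 1 = +-cong (+-cong (f≈g 0) (*-congˡ (f≈g 1))) (*-congˡ (f≈g 2))
      T-cong f≈g 2 = +-cong (+-cong (*-congˡ (f≈g 1)) (*-congˡ (f≈g 2))) (*-congˡ (f≈g 3))
      T-cong f≈g 3 = +-cong (*-congˡ (f≈g 2)) (*-congˡ (f≈g 3))
      T-cong f≈g (suc (suc (suc (suc _)))) = refl

      T-* : ∀ p f d → T (λ i → p * f i) d ≈ p * T f d
      T-* p f 0 = solve 3 (λ p k u → k :* (p :* u) := p :* (k :* u)) refl p k (f 1)
      T-* p f 1 = solve 6 (λ p a b u v w → p :* u :+ a :* (p :* v) :+ b :* (p :* w) := p :* (u :+ a :* v :+ b :* w)) refl p a₁ b₁ (f 0) (f 1) (f 2)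
      T-* p f 2 = solve 7 (λ p a b c u v w → c :* (p :* u) :+ a :* (p :* v) :+ b :* (p :* w) := p :* (c :* u :+ a :* v :+ b :* w)) refl p a₂ b₂ c₂ (f 1) (f 2) (f 3)
      T-* p f 3 = solve 5 (λ p a c u v → c :* (p :* u) :+ a :* (p :* v) := p :* (c :* u :+ a :* v)) refl p a₃ c₃ (f 2) (f 3)
      T-* p f (suc (suc (suc (suc _)))) = sym (zeroʳ p)

      T-+ : ∀ f g d → T (λ i → f i + g i) d ≈ T f d + T g d
      T-+ f g 0 = distribˡ k (f 1) (g 1)
      T-+ f g 1 = solve 8 (λ a b u v w x y z → u :+ x :+ a :* (v :+ y) :+ b :* (w :+ z) := u :+ a :* v :+ b :* w :+ (x :+ a :* y :+ b :* z))
        refl a₁ b₁ (f 0) (f 1) (f 2) (g 0) (g 1) (g 2)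
      T-+ f g 2 = solve 9 (λ a b c u v w x y z → c :* (u :+ x) :+ a :* (v :+ y) :+ b :* (w :+ z) := c :* u :+ a :* v :+ b :* w :+ (c :* x :+ a :* y :+ b :* z))
        refl a₂ b₂ c₂ (f 1) (f 2) (f 3) (g 1) (g 2) (g 3)
      T-+ f g 3 = solve 6 (λ a c u v x y → c :* (u :+ x) :+ a :* (v :+ y) := c :* u :+ a :* v :+ (c :* x :+ a :* y))
        refl a₃ c₃ (f 2) (f 3) (g 2) (g 3)
      T-+ f g (suc (suc (suc (suc _)))) = sym (+-identityʳ 0#)

      T²-e₀ : ∀ d → T^ 2 (e 0) d ≈ k * e 0 d + a₁ * e 1 d + c₂ * e 2 d
      T²-e₀ d = trans (T-cong T-e₀ d) (T-e₁ d)

      T³-e₀ : ∀ d → T^ 3 (e 0) d ≈ k * e 1 d + a₁ * (k * e 0 d + a₁ * e 1 d + c₂ * e 2 d) + c₂ * (b₁ * e 1 d + a₂ * e 2 d + c₃ * e 3 d)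
      T³-e₀ d = trans (T-cong T²-e₀ d)
        (trans (T-+ (λ i → k * e 0 i + a₁ * e 1 i) (λ i → c₂ * e 2 i) d) (+-cong
        (trans (T-+ (λ i → k * e 0 i) (λ i → a₁ * e 1 i) d) (+-cong
        (trans (T-* k (e 0) d) (*-congˡ (T-e₀ d)))
        (trans (T-* a₁ (e 1) d) (*-congˡ (T-e₁ d)))))
        (trans (T-* c₂ (e 2) d) (*-congˡ (T-e₂ d)))))

      ⟪e₁⟫ : ∀ v y → ⟪ e 1 , v ⟫ y ≈ (A *ᵥ v) y
      ⟪e₁⟫ v y = begin
        ⟪ e 1 , v ⟫ y          ≈⟨ ⟪⟫-cong v y T-e₀ ⟨
        ⟪ T (e 0) , v ⟫ y      ≈⟨ T-adjoint (e 0) v y ⟩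
        ⟪ e 0 , A *ᵥ v ⟫ y     ≈⟨ ⟪e₀⟫ (A *ᵥ v) y ⟩
        (A *ᵥ v) y             ∎

      ⟪Ae₁⟫ : ∀ v y → ⟪ e 1 , A *ᵥ v ⟫ y ≈ k * ⟪ e 0 , v ⟫ y + a₁ * ⟪ e 1 , v ⟫ y + c₂ * ⟪ e 2 , v ⟫ y
      ⟪Ae₁⟫ v y = trans (sym (T-adjoint (e 1) v y)) (trans (⟪⟫-cong v y T-e₁) (⟪⟫-combination₃ k (e 0) a₁ (e 1) c₂ (e 2) v y))

      ⟪Ae₂⟫ : ∀ v y → ⟪ e 2 , A *ᵥ v ⟫ y ≈ b₁ * ⟪ e 1 , v ⟫ y + a₂ * ⟪ e 2 , v ⟫ y + c₃ * ⟪ e 3 , v ⟫ y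
      ⟪Ae₂⟫ v y = trans (sym (T-adjoint (e 2) v y)) (trans (⟪⟫-cong v y T-e₂) (⟪⟫-combination₃ b₁ (e 1) a₂ (e 2) c₃ (e 3) v y))

      ⟪Ae₃⟫ : ∀ v y → ⟪ e 3 , A *ᵥ v ⟫ y ≈ b₂ * ⟪ e 2 , v ⟫ y + a₃ * ⟪ e 3 , v ⟫ y
      ⟪Ae₃⟫ v y = trans (sym (T-adjoint (e 3) v y)) (trans (⟪⟫-cong v y T-e₃)
        (trans (⟪⟫-+ (λ d → b₂ * e 2 d) (λ d → a₃ * e 3 d) v y) (+-cong (⟪⟫-* b₂ (e 2) v y) (⟪⟫-* a₃ (e 3) v y))))

      module Eigenvector {μ v} (Av≈μv : Eigenspace A μ v) (y : Fin order) where

        -- The sum of `v` over the sphere of radius i around `y`. The recurrence of the distance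
        -- matrices turns the eigenvector equation into linear relations between these sums.
        g : ℕ → Carrier
        g i = ⟪ e i , v ⟫ y

        ⟪Av⟫ : ∀ i → ⟪ e i , A *ᵥ v ⟫ y ≈ μ * g i
        ⟪Av⟫ i = trans (⟪⟫-congʳ (e i) y Av≈μv) (⟪⟫-*ʳ μ (e i) v y)

        g₀ : g 0 ≈ v y
        g₀ = ⟪e₀⟫ v y

        g₁ : g 1 ≈ μ * v y
        g₁ = trans (⟪e₁⟫ v y) (Av≈μv y)

        μg₁ : μ * g 1 ≈ k * v y + a₁ * g 1 + c₂ * g 2
        μg₁ = trans (sym (⟪Av⟫ 1)) (trans (⟪Ae₁⟫ v y) (+-congʳ (+-congʳ (*-congˡ g₀))))

        μg₂ : μ * g 2 ≈ b₁ * g 1 + a₂ * g 2 + c₃ * g 3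
        μg₂ = trans (sym (⟪Av⟫ 2)) (⟪Ae₂⟫ v y)

        μg₃ : μ * g 3 ≈ b₂ * g 2 + a₃ * g 3
        μg₃ = trans (sym (⟪Av⟫ 3)) (⟪Ae₃⟫ v y)

    -- The remaining eigenvalues when k = b s

    module Shilla
      (b s : ℤ)
      (k≡  : + b[ 0F ] ≡ b ℤ.* s)
      (b₁≡ : + b[ 1F ] ≡ (b ℤ.- 1ℤ) ℤ.* (s ℤ.+ 1ℤ))
      (c₃≡ : + c[ 3F ] ≡ (b ℤ.- 1ℤ) ℤ.* s)
      where

      -- ι1 is fromℤ 1ℤ, which reduces to 1# + 0# and is what the solver's con (+ 1)
      -- denotes.
      β σ B₂ C₂ ι1 : Carrier
      β  = fromℤ b
      σ  = fromℤ s
      B₂ = b[ 2F ] ×# 1#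
      C₂ = c[ 2F ] ×# 1#
      ι1 = 1 ×# 1#

      k≈ : b[ 0F ] ×# 1# ≈ β * σ
      k≈ = trans (reflexive (≡.cong fromℤ k≡)) (fromℤ-*-homo b s)

      b₁≈ : b[ 1F ] ×# 1# ≈ (β - ι1) * (σ + ι1)
      b₁≈ = trans (reflexive (≡.cong fromℤ b₁≡)) (fromℤ-≈ ((int b ⊖ int 1ℤ) ⊗ (int s ⊕ int 1ℤ)))

      c₃≈ : c[ 3F ] ×# 1# ≈ (β - ι1) * σ
      c₃≈ = trans (reflexive (≡.cong fromℤ c₃≡)) (fromℤ-≈ ((int b ⊖ int 1ℤ) ⊗ int s))

      a₁≈ : β * σ - (β - ι1) * (σ + ι1) - ι1 ≈ σ - β
      a₁≈ = solve 2 (λ β σ → β :* σ :- (β :- con (+ 1)) :* (σ :+ con (+ 1)) :- con (+ 1) := σ :- β) refl β σ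

      a₃≈ : β * σ - (β - ι1) * σ ≈ σ
      a₃≈ = solve 2 (λ β σ → β :* σ :- (β :- con (+ 1)) :* σ := σ) refl β σ

      open Radial k≈ b₁≈ {c₂ = C₂} refl {b₂ = B₂} refl c₃≈ a₁≈ {a₂ = β * σ - B₂ - C₂} refl a₃≈

      -- θ₂ and θ₃ are the roots of X² - τ X + π.
      τ π : Carrier
      τ = σ - β - (B₂ + C₂)
      π = β * B₂ + C₂ - β * σ

      -- Eliminating the sphere sums leaves `v y` times the characteristic polynomial of the
      -- intersection matrix, (X - k)(X - σ)(X² - τ X + π), and apartness removes the other factors
      -- one at a time. Working with `C₂ * g 2` avoids a division.
      quadratic : ∀ {μ} → IsEigenvalue A μ → μ # β * σ → μ # σ → μ * μ - τ * μ + π ≈ 0#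
      quadratic {μ} (v , Av≈μv , y , vy#0) μ#k μ#σ =
        #-zero-product μ#k (#0-zero-product vy#0 (#-zero-product μ#σ (begin
          (μ - σ) * (V * ((μ - β * σ) * (μ * μ - τ * μ + π)))
            ≈⟨ *-congˡ (*-congˡ (solve 5 (λ β σ B C μ →
                 (μ :- β :* σ) :* (μ :* μ :- (σ :- β :- (B :+ C)) :* μ :+ (β :* B :+ C :- β :* σ)) :=
                 (μ :- (β :* σ :- B :- C)) :* ((μ :- σ) :* (μ :+ β)) :- C :* ((β :- con (+ 1)) :* (σ :+ con (+ 1))) :* μ
                   :- (β :- con (+ 1)) :* σ :* B :* (μ :+ β)) refl β σ B₂ C₂ μ)) ⟩
          (μ - σ) * (V * ((μ - a₂) * ((μ - σ) * (μ + β)) - C₂ * b₁ * μ - c₃ * B₂ * (μ + β)))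
            ≈⟨ solve 9 (λ μ σ β V C B a b c →
                 (μ :- σ) :* (V :* ((μ :- a) :* ((μ :- σ) :* (μ :+ β)) :- C :* b :* μ :- c :* B :* (μ :+ β))) :=
                 (μ :- σ) :* (μ :- a) :* ((μ :- σ) :* (μ :+ β) :* V) :- (μ :- σ) :* C :* b :* (μ :* V) :- c :* B :* ((μ :- σ) :* (μ :+ β) :* V))
                 refl μ σ β V C₂ B₂ a₂ b₁ c₃ ⟩
          (μ - σ) * (μ - a₂) * ((μ - σ) * (μ + β) * V) - (μ - σ) * C₂ * b₁ * (μ * V) - c₃ * B₂ * ((μ - σ) * (μ + β) * V)
            ≈⟨ +-cong (+-cong (*-congˡ C₂g₂) (-‿cong (*-congˡ g₁))) (-‿cong (*-congˡ C₂g₂)) ⟨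
          (μ - σ) * (μ - a₂) * (C₂ * g 2) - (μ - σ) * C₂ * b₁ * g 1 - c₃ * B₂ * (C₂ * g 2)
            ≈⟨ solve 10 (λ μ σ C B a b c g₁ g₂ g₃ →
                 (μ :- σ) :* (μ :- a) :* (C :* g₂) :- (μ :- σ) :* C :* b :* g₁ :- c :* B :* (C :* g₂) :=
                 (μ :- σ) :* C :* (μ :* g₂ :- (b :* g₁ :+ a :* g₂ :+ c :* g₃)) :+ C :* c :* (μ :* g₃ :- (B :* g₂ :+ σ :* g₃)))
                 refl μ σ C₂ B₂ a₂ b₁ c₃ (g 1) (g 2) (g 3) ⟩
          -- The multipliers of the two recurrences are chosen so that `g 3` cancels.
          (μ - σ) * C₂ * (μ * g 2 - (b₁ * g 1 + a₂ * g 2 + c₃ * g 3)) + C₂ * c₃ * (μ * g 3 - (B₂ * g 2 + σ * g 3))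
            ≈⟨ +-cong (*-congˡ (x≈y⇒x-y≈0 μg₂)) (*-congˡ (x≈y⇒x-y≈0 μg₃)) ⟩
          (μ - σ) * C₂ * 0# + C₂ * c₃ * 0#
            ≈⟨ +-cong (zeroʳ _) (zeroʳ _) ⟩
          0# + 0#
            ≈⟨ +-identityʳ 0# ⟩
          0# ∎)))
        where
        open Eigenvector Av≈μv y
        V a₂ b₁ c₃ : Carrier
        V  = v y
        a₂ = β * σ - B₂ - C₂
        b₁ = (β - ι1) * (σ + ι1)
        c₃ = (β - ι1) * σ

        C₂g₂ : C₂ * g 2 ≈ (μ - σ) * (μ + β) * V
        C₂g₂ = begin
          C₂ * g 2
            ≈⟨ solve 2 (λ c u → c := u :+ c :- u) refl (C₂ * g 2) (β * σ * V + (σ - β) * g 1) ⟩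
          β * σ * V + (σ - β) * g 1 + C₂ * g 2 - (β * σ * V + (σ - β) * g 1)
            ≈⟨ +-cong (sym μg₁) (-‿cong (+-congˡ (*-congˡ g₁))) ⟩
          μ * g 1 - (β * σ * V + (σ - β) * (μ * V))
            ≈⟨ +-congʳ (*-congˡ g₁) ⟩
          μ * (μ * V) - (β * σ * V + (σ - β) * (μ * V))
            ≈⟨ solve 4 (λ μ β σ V → μ :* (μ :* V) :- (β :* σ :* V :+ (σ :- β) :* (μ :* V)) := (μ :- σ) :* (μ :+ β) :* V) refl μ β σ V ⟩
          (μ - σ) * (μ + β) * V ∎

      C₃ : Carrier
      C₃ = (β - ι1) * σ

      quadratic-roots : ∀ {μ ν} → μ # ν → μ * μ - τ * μ + π ≈ 0# → ν * ν - τ * ν + π ≈ 0# →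
                        μ + ν ≈ τ × μ * ν ≈ π
      quadratic-roots {μ} {ν} μ#ν μ-root ν-root = sum , product
        where
        sum : μ + ν ≈ τ
        sum = x-y≈0⇒x≈y (#-zero-product μ#ν (begin
          (μ - ν) * (μ + ν - τ)                                ≈⟨ solve 4 (λ μ ν τ π → (μ :- ν) :* (μ :+ ν :- τ) := μ :* μ :- τ :* μ :+ π :- (ν :* ν :- τ :* ν :+ π)) refl μ ν τ π ⟩
          μ * μ - τ * μ + π - (ν * ν - τ * ν + π)              ≈⟨ +-cong μ-root (-‿cong ν-root) ⟩
          0# - 0#                                              ≈⟨ -‿inverseʳ 0# ⟩
          0#                                                   ∎))

        product : μ * ν ≈ π
        product = begin
          μ * ν                                                ≈⟨ solve 4 (λ μ ν τ π → μ :* ν := μ :* (μ :+ ν) :- (μ :* μ :- τ :* μ :+ π) :+ π :- μ :* τ) refl μ ν τ π ⟩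
          μ * (μ + ν) - (μ * μ - τ * μ + π) + π - μ * τ        ≈⟨ +-congʳ (+-congʳ (+-cong (*-congˡ sum) (-‿cong μ-root))) ⟩
          μ * τ - 0# + π - μ * τ                               ≈⟨ solve 2 (λ x π → x :- con (+ 0) :+ π :- x := π) refl (μ * τ) π ⟩
          π                                                    ∎

      module _ {θ₂ θ₃ : Carrier} (sum≈τ : θ₂ + θ₃ ≈ τ) (product≈π : θ₂ * θ₃ ≈ π) where

        -- Hoffman's polynomial: the factors for all eigenvalues but k multiply to a multiple of J.
        -- The scalar is c₂ c₃ because vertices at distance three are joined by that many walks of
        -- length three and by no shorter ones.
        cubic : ∀ x y → Δs (σ ∷ θ₂ ∷ θ₃ ∷ []) (λ j → power A j y x) 0 ≈ C₂ * C₃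
        cubic x y = begin
          Δs (σ ∷ θ₂ ∷ θ₃ ∷ []) (λ j → power A j y x) 0
            ≈⟨ Δs-three σ θ₂ θ₃ (λ j → power A j y x) ⟩
          power A 3 y x - (σ + (θ₂ + θ₃)) * power A 2 y x + (θ₂ * θ₃ + σ * (θ₂ + θ₃)) * power A 1 y x - σ * (θ₂ * θ₃) * power A 0 y x
            ≈⟨ +-cong (+-cong (+-cong
                 (trans (power-radial 3 x y) (T³-e₀ d))
                 (-‿cong (*-cong (+-congˡ sum≈τ) (trans (power-radial 2 x y) (T²-e₀ d)))))
                 (*-cong (+-cong product≈π (*-congˡ sum≈τ)) (trans (power-radial 1 x y) (T-e₀ d))))
                 (-‿cong (*-cong (*-congˡ product≈π) (power-radial 0 x y))) ⟩
          k * e₁ + a₁ * (k * e₀ + a₁ * e₁ + C₂ * e₂) + C₂ * (b₁ * e₁ + a₂ * e₂ + C₃ * e₃)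
            - (σ + τ) * (k * e₀ + a₁ * e₁ + C₂ * e₂) + (π + σ * τ) * e₁ - σ * π * e₀
            ≈⟨ solve 8 (λ β σ B C e₀ e₁ e₂ e₃ →
                 let k = β :* σ ; b₁ = (β :- con (+ 1)) :* (σ :+ con (+ 1)) ; a₁ = σ :- β ; a₂ = β :* σ :- B :- C ; c₃ = (β :- con (+ 1)) :* σ
                     τ = σ :- β :- (B :+ C) ; π = β :* B :+ C :- β :* σ in
                 k :* e₁ :+ a₁ :* (k :* e₀ :+ a₁ :* e₁ :+ C :* e₂) :+ C :* (b₁ :* e₁ :+ a₂ :* e₂ :+ c₃ :* e₃)
                   :- (σ :+ τ) :* (k :* e₀ :+ a₁ :* e₁ :+ C :* e₂) :+ (π :+ σ :* τ) :* e₁ :- σ :* π :* e₀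
                 := C :* c₃ :* (e₀ :+ e₁ :+ e₂ :+ e₃)) refl β σ B₂ C₂ e₀ e₁ e₂ e₃ ⟩
          C₂ * C₃ * (e₀ + e₁ + e₂ + e₃)
            ≈⟨ trans (*-congˡ (e-partition (dist≤3 x y))) (*-identityʳ _) ⟩
          C₂ * C₃ ∎
          where
          d = dist x y
          k  = β * σ
          b₁ = (β - ι1) * (σ + ι1)
          a₁ = σ - β
          a₂ = β * σ - B₂ - C₂
          e₀ e₁ e₂ e₃ : Carrier
          e₀ = e 0 d
          e₁ = e 1 d
          e₂ = e 2 d
          e₃ = e 3 d

        -- `A` multiplies the constant columns of c₂ c₃ J by the valency.
        annihilates : ∀ y x → Δs (β * σ ∷ σ ∷ θ₂ ∷ θ₃ ∷ []) (λ j → power A j y x) 0 ≈ 0#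
        annihilates y x = begin
          Δs (β * σ ∷ as) (λ j → power A j y x) 0
            ≈⟨ Δ-unfold (β * σ) (Δs as (λ j → power A j y x)) 0 ⟩
          Δs as (λ j → power A j y x) 1 - β * σ * Δs as (λ j → power A j y x) 0
            ≈⟨ +-cong (sym (Δs-power-suc A as y x)) (-‿cong (*-congˡ (cubic x y))) ⟩
          (A *ᵥ λ z → Δs as (λ j → power A j z x) 0) y - β * σ * (C₂ * C₃)
            ≈⟨ +-congʳ (∑-cong {order} λ z → *-congˡ (cubic x z)) ⟩
          (A *ᵥ λ _ → C₂ * C₃) y - β * σ * (C₂ * C₃)
            ≈⟨ x≈y⇒x-y≈0 (A-rows (C₂ * C₃) y) ⟩
          0# ∎
          where
          as : List Carrier
          as = σ ∷ θ₂ ∷ θ₃ ∷ []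

        ∏-valency : ∏[ β * σ - (σ ∷ θ₂ ∷ θ₃ ∷ []) ] ≈ (β * σ - σ) * (β * σ * (β * σ) - τ * (β * σ) + π)
        ∏-valency = begin
          (k - σ) * ((k - θ₂) * ((k - θ₃) * 1#))               ≈⟨ *-congˡ (*-congˡ (*-identityʳ _)) ⟩
          (k - σ) * ((k - θ₂) * (k - θ₃))                      ≈⟨ *-congˡ (solve 3 (λ k x y → (k :- x) :* (k :- y) := k :* k :- (x :+ y) :* k :+ x :* y) refl k θ₂ θ₃) ⟩
          (k - σ) * (k * k - (θ₂ + θ₃) * k + θ₂ * θ₃)          ≈⟨ *-congˡ (+-cong (+-congˡ (-‿cong (*-congʳ sum≈τ))) product≈π) ⟩
          (k - σ) * (k * k - τ * k + π)                        ∎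
          where k = β * σ

        -- The two sides of `cubic` are applied to the all-ones vector, an eigenvector for k.
        order-equation : order ×# 1# * (C₂ * C₃) ≈ ∏[ β * σ - (σ ∷ θ₂ ∷ θ₃ ∷ []) ]
        order-equation = begin
          order ×# 1# * (C₂ * C₃)                              ≈⟨ *-congʳ (sum-replicate order) ⟨
          (∑[ z < order ] 1#) * (C₂ * C₃)                      ≈⟨ *-distribʳ-sum {order} (C₂ * C₃) (λ _ → 1#) ⟩
          ∑[ z < order ] (1# * (C₂ * C₃))                      ≈⟨ ∑-cong {order} (λ z → trans (*-comm _ _) (*-congʳ (sym (cubic z x)))) ⟩
          ∑[ z < order ] (Δs as (λ j → power A j x z) 0 * 1#)  ≈⟨ Δs-power-*ᵥ-eigenvector A as {v = λ _ → 1#} (A-rows 1#) x ⟩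
          ∏[ β * σ - as ] * 1#                                 ≈⟨ *-identityʳ _ ⟩
          ∏[ β * σ - as ]                                      ∎
          where
          as : List Carrier
          as = σ ∷ θ₂ ∷ θ₃ ∷ []

        -- The trace of c₂ c₃ J is computed from its diagonal and by `trace-Δs-power`. Cancelling n
        -- c₂ c₃ then yields `m₀≡1`.
        multiplicity₀ : ∀ {m} → HasDimension (Eigenspace A (β * σ)) m →
                        order ×# 1# * (C₂ * C₃) ≈ m ×# 1# * (order ×# 1# * (C₂ * C₃))
        multiplicity₀ {m} dim = begin
          order ×# 1# * (C₂ * C₃)                              ≈⟨ *-congʳ (sum-replicate order) ⟨
          (∑[ z < order ] 1#) * (C₂ * C₃)                      ≈⟨ *-distribʳ-sum {order} (C₂ * C₃) (λ _ → 1#) ⟩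
          ∑[ z < order ] (1# * (C₂ * C₃))                      ≈⟨ ∑-cong {order} (λ z → trans (*-identityˡ _) (sym (cubic z z))) ⟩
          ∑[ z < order ] Δs as (λ j → power A j z z) 0         ≈⟨ Δs-∑ {order} as (λ z j → power A j z z) 0 ⟨
          Δs as (λ j → ∑[ z < order ] power A j z z) 0         ≈⟨ trace-Δs-power A as dim annihilates ⟩
          m ×# 1# * ∏[ β * σ - as ]                            ≈⟨ *-congˡ order-equation ⟨
          m ×# 1# * (order ×# 1# * (C₂ * C₃))                  ∎
          where
          as : List Carrier
          as = σ ∷ θ₂ ∷ θ₃ ∷ []

      traces : ∀ j → ∑[ z < order ] power A j z z ≈ order ×# 1# * T^ j (e 0) 0
      traces j = begin
        ∑[ z < order ] power A j z z                     ≈⟨ ∑-cong {order} (λ z → trans (power-radial j z z)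
                                                              (reflexive (≡.cong (T^ j (e 0)) (dist-≡ (Distance-refl z))))) ⟩
        ∑[ z < order ] T^ j (e 0) 0                      ≈⟨ ∑-cong {order} (λ _ → sym (*-identityˡ _)) ⟩
        ∑[ z < order ] (1# * T^ j (e 0) 0)               ≈⟨ *-distribʳ-sum {order} (T^ j (e 0) 0) (λ _ → 1#) ⟨
        (∑[ z < order ] 1#) * T^ j (e 0) 0               ≈⟨ *-congʳ (sum-replicate order) ⟩
        order ×# 1# * T^ j (e 0) 0                       ∎

      -- Nonnegative intersection numbers

      -- The difference is a₁, the number of common neighbours of the adjacent vertices `x` and `p`.
      0≤s-b : 0ℤ ℤ.≤ s ℤ.- b
      0≤s-b = ≡.subst (0ℤ ℤ.≤_) (fromℤ-injective {+ proj₁ count} (begin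
          proj₁ count ×# 1#                              ≈⟨ proj₂ count ⟨
          (A *ᵥ λ z → e 1 (dist x z)) p                  ≈⟨ A-radial-at (e 1) 1 (s≤s z≤n) d-xp ⟩
          T (e 1) 1                                      ≈⟨ T-e₁ 1 ⟩
          β * σ * 0# + (σ - β) * ι1 + C₂ * 0#            ≈⟨ solve 4 (λ k a c o → k :* con (+ 0) :+ a :* con (+ 1) :+ c :* con (+ 0) := a) refl (β * σ) (σ - β) C₂ 1# ⟩
          σ - β                                          ≈⟨ fromℤ-minus s b ⟨
          fromℤ (s ℤ.- b)                                ∎)) (+≤+ z≤n)
        where
        count : ∃[ N ] ∑[ z < order ] (A p z * e 1 (dist x z)) ≈ N ×# 1#
        count = ∑-indicator (λ z → A p z * e 1 (dist x z)) (λ z → 0∨1 (A-0∨1 p z) (e-0∨1 1 (dist x z)))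

      b₂ c₂ : ℤ
      b₂ = + b[ 2F ]
      c₂ = + c[ 2F ]

      C₃#0 : C₃ # 0#
      C₃#0 = #-congʳ c₃≈ (positive#0 0<c₃)

      module _ where
        open Eigenvector {v = λ _ → 1#} (A-rows 1#) x

        -- For the all-ones vector the sphere sums are the sphere sizes kᵢ; this is c₂ c₃ k₃ = k b₁
        -- b₂ with the common factor c₃ removed.
        C₂K₃ : C₂ * g 3 ≈ β * (σ + ι1) * B₂
        C₂K₃ = x-y≈0⇒x≈y (#0-zero-product C₃#0 (begin
          C₃ * (C₂ * g 3 - β * (σ + ι1) * B₂)
            ≈⟨ solve 6 (λ β σ B C g₂ g₃ →
                 (β :- con (+ 1)) :* σ :* (C :* g₃ :- β :* (σ :+ con (+ 1)) :* B) :=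
                 C :* (β :* σ :* g₃ :- (B :* g₂ :+ σ :* g₃)) :- B :* (β :* σ :* (β :* σ) :- (β :* σ :+ (σ :- β) :* (β :* σ) :+ C :* g₂)))
                 refl β σ B₂ C₂ (g 2) (g 3) ⟩
          C₂ * (β * σ * g 3 - (B₂ * g 2 + σ * g 3)) - B₂ * (β * σ * (β * σ) - (β * σ + (σ - β) * (β * σ) + C₂ * g 2))
            ≈⟨ +-cong (*-congˡ (x≈y⇒x-y≈0 μg₃)) (-‿cong (*-congˡ (x≈y⇒x-y≈0
                 (trans (*-congˡ (sym g₁′)) (trans μg₁ (+-congʳ (+-cong (*-identityʳ _) (*-congˡ g₁′)))))))) ⟩
          C₂ * 0# - B₂ * 0#
            ≈⟨ +-cong (zeroʳ C₂) (-‿cong (zeroʳ B₂)) ⟩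
          0# - 0#
            ≈⟨ -‿inverseʳ 0# ⟩
          0# ∎))
          where
          g₁′ : g 1 ≈ β * σ
          g₁′ = trans g₁ (*-identityʳ _)

        K₃ : Carrier
        K₃ = g 3

      -- The right-hand side is c₂ p³₃₃.
      p³₃₃-nonneg : 0ℤ ℤ.≤ b₂ ℤ.* (s ℤ.+ b) ℤ.- c₂ ℤ.* (s ℤ.+ 1ℤ)
      p³₃₃-nonneg =
        ≡.subst (0ℤ ℤ.≤_) (↦-injective (int c₂ ⊗ int (+ N)) (int b₂ ⊗ (int s ⊕ int b) ⊖ int c₂ ⊗ (int s ⊕ int 1ℤ)) (begin
          C₂ * (N ×# 1#)
            ≈⟨ *-congˡ (proj₂ count) ⟨
          C₂ * F 3
            ≈⟨ solve 5 (λ C f₀ f₁ f₂ f₃ → C :* f₃ := C :* (f₀ :+ f₁ :+ f₂ :+ f₃) :- C :* f₀ :- C :* f₁ :- C :* f₂) refl C₂ (F 0) (F 1) (F 2) (F 3) ⟩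
          C₂ * (F 0 + F 1 + F 2 + F 3) - C₂ * F 0 - C₂ * F 1 - C₂ * F 2
            ≈⟨ +-cong (+-cong (+-cong (trans (*-congˡ F-total) C₂K₃) (-‿cong (*-congˡ F₀))) (-‿cong (*-congˡ F₁))) (-‿cong C₂F₂) ⟩
          β * (σ + ι1) * B₂ - C₂ * ι1 - C₂ * σ - C₃ * B₂
            ≈⟨ solve 4 (λ β σ B C → β :* (σ :+ con (+ 1)) :* B :- C :* con (+ 1) :- C :* σ :- (β :- con (+ 1)) :* σ :* B :=
                                    B :* (σ :+ β) :- C :* (σ :+ con (+ 1))) refl β σ B₂ C₂ ⟩
          B₂ * (σ + β) - C₂ * (σ + ι1) ∎)) (≡.subst (0ℤ ℤ.≤_) (ℤ.pos-* c[ 2F ] N) (+≤+ z≤n))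
        where
        count : ∃[ N ] ∑[ z < order ] (e 3 (dist y z) * e 3 (dist x z)) ≈ N ×# 1#
        count = ∑-indicator (λ z → e 3 (dist y z) * e 3 (dist x z)) (λ z → 0∨1 (e-0∨1 3 (dist y z)) (e-0∨1 3 (dist x z)))

        N : ℕ
        N = proj₁ count

        w : Vector Carrier order
        w z = e 3 (dist x z)

        -- As `x` and `y` are at distance three, `F i` is p³ᵢ₃. The value `F 3` is what the other
        -- three leave of the sphere size k₃.
        F : ℕ → Carrier
        F i = ⟪ e i , w ⟫ y

        F₀ : F 0 ≈ ι1
        F₀ = trans (⟪e₀⟫ w y) (reflexive (≡.cong (e 3) (dist-≡ d-xy)))

        Aw : ∀ z → (A *ᵥ w) z ≈ T (e 3) (dist x z)
        Aw z = A-radial (e 3) x z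

        T-e₃-3 : T (e 3) 3 ≈ σ
        T-e₃-3 = solve 2 (λ c a → c :* con (+ 0) :+ a :* con (+ 1) := a) refl C₃ σ

        F₁ : F 1 ≈ σ
        F₁ = trans (⟪e₁⟫ w y) (trans (A-radial-at (e 3) 3 ℕ.≤-refl d-xy) T-e₃-3)

        AAw : (A *ᵥ (A *ᵥ w)) y ≈ C₃ * B₂ + σ * σ
        AAw = begin
          (A *ᵥ (A *ᵥ w)) y                            ≈⟨ ∑-cong {order} (λ z → *-congˡ (Aw z)) ⟩
          (A *ᵥ λ z → T (e 3) (dist x z)) y            ≈⟨ A-radial-at (T (e 3)) 3 ℕ.≤-refl d-xy ⟩
          C₃ * T (e 3) 2 + σ * T (e 3) 3               ≈⟨ +-cong (*-congˡ (trans (T-e₃ 2) (solve 2 (λ b a → b :* con (+ 1) :+ a :* con (+ 0) := b) refl B₂ σ))) (*-congˡ T-e₃-3) ⟩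
          C₃ * B₂ + σ * σ                              ∎

        -- The recurrence gives c₂ A₂ = A² - a₁ A - k I, here applied to `w`.
        C₂F₂ : C₂ * F 2 ≈ C₃ * B₂
        C₂F₂ = begin
          C₂ * F 2
            ≈⟨ solve 5 (λ β σ C f₂ o → C :* f₂ := β :* σ :* con (+ 1) :+ (σ :- β) :* σ :+ C :* f₂ :- σ :* σ) refl β σ C₂ (F 2) 1# ⟩
          β * σ * ι1 + (σ - β) * σ + C₂ * F 2 - σ * σ
            ≈⟨ +-congʳ (+-congʳ (+-cong (*-congˡ F₀) (*-congˡ F₁))) ⟨
          β * σ * F 0 + (σ - β) * F 1 + C₂ * F 2 - σ * σ
            ≈⟨ +-congʳ (trans (sym (⟪Ae₁⟫ w y)) (trans (⟪e₁⟫ (A *ᵥ w) y) AAw)) ⟩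
          C₃ * B₂ + σ * σ - σ * σ
            ≈⟨ solve 2 (λ u v → u :+ v :- v := u) refl (C₃ * B₂) (σ * σ) ⟩
          C₃ * B₂ ∎

        F-total : F 0 + F 1 + F 2 + F 3 ≈ K₃
        F-total = begin
          F 0 + F 1 + F 2 + F 3
            ≈⟨ +-congʳ (+-congʳ (⟪⟫-+ (e 0) (e 1) w y)) ⟨
          ⟪ (λ d → e 0 d + e 1 d) , w ⟫ y + F 2 + F 3
            ≈⟨ +-congʳ (⟪⟫-+ (λ d → e 0 d + e 1 d) (e 2) w y) ⟨
          ⟪ (λ d → e 0 d + e 1 d + e 2 d) , w ⟫ y + F 3
            ≈⟨ ⟪⟫-+ (λ d → e 0 d + e 1 d + e 2 d) (e 3) w y ⟨
          ⟪ (λ d → e 0 d + e 1 d + e 2 d + e 3 d) , w ⟫ y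
            ≈⟨ ∑-cong {order} (λ z → trans (*-congʳ (e-partition (dist≤3 y z))) (*-comm _ _)) ⟩
          ⟪ e 3 , (λ _ → 1#) ⟫ x ∎

      -- The multiplicity equations over the integers

      HasDimension-cong : ∀ {μ ν m} → μ ≈ ν → HasDimension (Eigenspace A μ) m → HasDimension (Eigenspace A ν) m
      HasDimension-cong μ≈ν (B , isBasis) = B , record
        { member      = λ j x → trans (member j x) (*-congʳ μ≈ν)
        ; independent = independent
        ; spanning    = λ v Av≈νv → spanning v λ x → trans (Av≈νv x) (*-congʳ (sym μ≈ν))
        }
        where open IsBasis isBasis

      t π′ : ℤ
      t  = s ℤ.- b ℤ.- (b₂ ℤ.+ c₂)
      π′ = b ℤ.* b₂ ℤ.+ c₂ ℤ.- b ℤ.* s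

      t↦τ : t ↦ τ
      t↦τ = int s ⊖ int b ⊖ (int b₂ ⊕ int c₂)

      π′↦π : π′ ↦ π
      π′↦π = int b ⊗ int b₂ ⊕ int c₂ ⊖ int b ⊗ int s

      -- With θ₂ and θ₃ of equal multiplicity the traces involve only their symmetric functions `t`
      -- and `π′`, which is why these equations hold in ℤ.
      record MultiplicityEquations (m₁ m₂ : ℤ) : Set where
        field
          n-array : + order ℤ.* (c₂ ℤ.* ((b ℤ.- 1ℤ) ℤ.* s)) ≡ (b ℤ.* s ℤ.- s) ℤ.* (b ℤ.* s ℤ.* (b ℤ.* s) ℤ.- t ℤ.* (b ℤ.* s) ℤ.+ π′)
          trace₀  : + order ≡ 1ℤ ℤ.+ m₁ ℤ.+ (m₂ ℤ.+ m₂)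
          trace₁  : 0ℤ ≡ b ℤ.* s ℤ.+ m₁ ℤ.* s ℤ.+ m₂ ℤ.* t
          trace₂  : + order ℤ.* (b ℤ.* s) ≡ b ℤ.* s ℤ.* (b ℤ.* s) ℤ.+ m₁ ℤ.* (s ℤ.* s) ℤ.+ m₂ ℤ.* (t ℤ.* t ℤ.- (π′ ℤ.+ π′))

      module _ {θ : Fin 4 → Carrier} {m : Fin 4 → ℕ} (isSpectrum : IsSpectrum graph θ m)
               (θ₁≈σ : θ 1F ≈ σ) (s<k : s ℤ.< b ℤ.* s) (m₂≡m₃ : m 2F ≡ m 3F) where
        open IsSpectrum isSpectrum

        σ<βσ : σ < β * σ
        σ<βσ = <.<-respʳ-≈ (fromℤ-≈ (int b ⊗ int s)) (fromℤ-mono-< s<k)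

        -- The all-ones vector makes k an eigenvalue, `exhaustive` names its index, and k > s = θ₁
        -- leaves only index zero.
        θ₀≈k : θ 0F ≈ β * σ
        θ₀≈k = first (exhaustive (β * σ) ((λ _ → 1#) , A-rows 1# , x , 1#0))
          where
          k≉ : ∀ {i} → θ i < θ 1F → ¬ β * σ ≈ θ i
          k≉ θᵢ<θ₁ k≈θᵢ = <.asym σ<βσ (<.<-respʳ-≈ θ₁≈σ (<.<-respˡ-≈ (sym k≈θᵢ) θᵢ<θ₁))

          first : ∃[ i ] β * σ ≈ θ i → θ 0F ≈ β * σ
          first (0F , k≈θ₀) = sym k≈θ₀
          first (1F , k≈θ₁) = contradiction σ<βσ (<.irrefl (sym (trans k≈θ₁ θ₁≈σ)))
          first (2F , k≈θ₂) = contradiction k≈θ₂ (k≉ (decreasing (s≤s (s≤s z≤n))))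
          first (3F , k≈θ₃) = contradiction k≈θ₃ (k≉ (decreasing (s≤s (s≤s z≤n))))

        k#σ : β * σ # σ
        k#σ = <⇒# σ<βσ

        σ#θ₂ : σ # θ 2F
        σ#θ₂ = <⇒# (<.<-respʳ-≈ θ₁≈σ (decreasing (s≤s (s≤s z≤n))))

        σ#θ₃ : σ # θ 3F
        σ#θ₃ = <⇒# (<.<-respʳ-≈ θ₁≈σ (decreasing (s≤s (s≤s z≤n))))

        k#θ₂ : β * σ # θ 2F
        k#θ₂ = <⇒# (<.<-respʳ-≈ θ₀≈k (decreasing (s≤s z≤n)))

        k#θ₃ : β * σ # θ 3F
        k#θ₃ = <⇒# (<.<-respʳ-≈ θ₀≈k (decreasing (s≤s z≤n)))

        θ₂#θ₃ : θ 2F # θ 3F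
        θ₂#θ₃ = <⇒# (decreasing (s≤s (s≤s (s≤s z≤n))))

        θ₂θ₃ : θ 2F + θ 3F ≈ τ × θ 2F * θ 3F ≈ π
        θ₂θ₃ = quadratic-roots θ₂#θ₃ (quadratic (eigenvalue 2F) (#-sym k#θ₂) (#-sym σ#θ₂)) (quadratic (eigenvalue 3F) (#-sym k#θ₃) (#-sym σ#θ₃))

        sum≈τ : θ 2F + θ 3F ≈ τ
        sum≈τ = proj₁ θ₂θ₃

        product≈π : θ 2F * θ 3F ≈ π
        product≈π = proj₂ θ₂θ₃

        dim₀ : HasDimension (Eigenspace A (β * σ)) (m 0F)
        dim₀ = HasDimension-cong θ₀≈k (multiplicity 0F)

        dim₁ : HasDimension (Eigenspace A σ) (m 1F)
        dim₁ = HasDimension-cong θ₁≈σ (multiplicity 1F)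

        n↦ : + order ↦ order ×# 1#
        n↦ = int (+ order)

        c₃ : ℤ
        c₃ = (b ℤ.- 1ℤ) ℤ.* s

        c₃↦ : c₃ ↦ C₃
        c₃↦ = (int b ⊖ int 1ℤ) ⊗ int s

        k↦ : b ℤ.* s ↦ β * σ
        k↦ = int b ⊗ int s

        m₀≡1 : + m 0F ≡ 1ℤ
        m₀≡1 = ℤ.*-cancelʳ-≡ (+ m 0F) 1ℤ (+ order ℤ.* (c₂ ℤ.* + c[ 3F ])) {{nonZero}}
          (≡.trans (≡.cong (λ i → + m 0F ℤ.* (+ order ℤ.* (c₂ ℤ.* i))) c₃≡)
          (≡.trans (≡.sym (↦-injective (n↦ ⊗ (int c₂ ⊗ c₃↦)) (int (+ m 0F) ⊗ (n↦ ⊗ (int c₂ ⊗ c₃↦))) (multiplicity₀ sum≈τ product≈π dim₀)))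
          (≡.trans (≡.cong (λ i → + order ℤ.* (c₂ ℤ.* i)) (≡.sym c₃≡)) (≡.sym (ℤ.*-identityˡ _)))))
          where
          0<order : ∀ {n} → Fin n → 0 ℕ.< n
          0<order zero    = s≤s z≤n
          0<order (suc _) = s≤s z≤n

          nonZero : ℤ.NonZero (+ order ℤ.* (c₂ ℤ.* + c[ 3F ]))
          nonZero = ℤ.i*j≢0 (+ order) (c₂ ℤ.* + c[ 3F ]) {{ℕ.>-nonZero (0<order x)}}
            {{ℤ.i*j≢0 c₂ (+ c[ 3F ]) {{ℕ.>-nonZero 0<c₂}} {{ℕ.>-nonZero 0<c₃}}}}

        private
          M₁ M₂ : Carrier
          M₁ = m 1F ×# 1#
          M₂ = m 2F ×# 1#

          P : ℕ → Carrier
          P = powerSum A k#σ k#θ₂ k#θ₃ σ#θ₂ σ#θ₃ θ₂#θ₃ dim₀ dim₁ (multiplicity 2F) (multiplicity 3F) (annihilates sum≈τ product≈π)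

          traces≈P : _
          traces≈P = traces≈powerSums A k#σ k#θ₂ k#θ₃ σ#θ₂ σ#θ₃ θ₂#θ₃ dim₀ dim₁ (multiplicity 2F) (multiplicity 3F) (annihilates sum≈τ product≈π)

          M₀≈1 : m 0F ×# 1# ≈ ι1
          M₀≈1 = reflexive (≡.cong fromℤ m₀≡1)

          M₃≈M₂ : m 3F ×# 1# ≈ M₂
          M₃≈M₂ = reflexive (≡.cong (_×# 1#) (≡.sym m₂≡m₃))

        multiplicityEquations : MultiplicityEquations (+ m 1F) (+ m 2F)
        multiplicityEquations = record
          { n-array = ↦-injective (n↦ ⊗ (int c₂ ⊗ c₃↦)) ((k↦ ⊖ int s) ⊗ (k↦ ⊗ k↦ ⊖ t↦τ ⊗ k↦ ⊕ π′↦π))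
              (trans (order-equation sum≈τ product≈π) (∏-valency sum≈τ product≈π))
          ; trace₀ = ↦-injective n↦ (int 1ℤ ⊕ int (+ m 1F) ⊕ (int (+ m 2F) ⊕ int (+ m 2F))) (begin
              order ×# 1#                                      ≈⟨ solve 1 (λ n → n := n :* con (+ 1)) refl (order ×# 1#) ⟩
              order ×# 1# * ι1                                 ≈⟨ traces 0 ⟨
              ∑[ z < order ] power A 0 z z                     ≈⟨ proj₁ traces≈P ⟩
              P 0                                              ≈⟨ +-cong (+-cong (+-cong (trans (*-identityʳ _) M₀≈1) (*-identityʳ _)) (*-identityʳ _)) (trans (*-identityʳ _) M₃≈M₂) ⟩
              ι1 + M₁ + M₂ + M₂                                ≈⟨ +-assoc _ _ _ ⟩
              ι1 + M₁ + (M₂ + M₂)                              ∎)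
          ; trace₁ = ↦-injective (int 0ℤ) (k↦ ⊕ int (+ m 1F) ⊗ int s ⊕ int (+ m 2F) ⊗ t↦τ) (begin
              0#                                               ≈⟨ solve 2 (λ n k → con (+ 0) := n :* (k :* con (+ 0))) refl (order ×# 1#) (β * σ) ⟩
              order ×# 1# * (β * σ * 0#)                       ≈⟨ traces 1 ⟨
              ∑[ z < order ] power A 1 z z                     ≈⟨ proj₁ (proj₂ traces≈P) ⟩
              P 1                                              ≈⟨ +-cong (+-cong (+-cong (*-cong M₀≈1 (*-identityʳ _)) (*-congˡ (*-identityʳ _))) (*-congˡ (*-identityʳ _))) (*-cong M₃≈M₂ (*-identityʳ _)) ⟩
              ι1 * (β * σ) + M₁ * σ + M₂ * θ 2F + M₂ * θ 3F    ≈⟨ solve 6 (λ k σ M₁ M₂ x y → con (+ 1) :* k :+ M₁ :* σ :+ M₂ :* x :+ M₂ :* y := k :+ M₁ :* σ :+ M₂ :* (x :+ y))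
                                                                   refl (β * σ) σ M₁ M₂ (θ 2F) (θ 3F) ⟩
              β * σ + M₁ * σ + M₂ * (θ 2F + θ 3F)              ≈⟨ +-congˡ (*-congˡ sum≈τ) ⟩
              β * σ + M₁ * σ + M₂ * τ                          ∎)
          ; trace₂ = ↦-injective (n↦ ⊗ k↦) (k↦ ⊗ k↦ ⊕ int (+ m 1F) ⊗ (int s ⊗ int s) ⊕ int (+ m 2F) ⊗ (t↦τ ⊗ t↦τ ⊖ (π′↦π ⊕ π′↦π))) (begin
              order ×# 1# * (β * σ)                            ≈⟨ *-congˡ (solve 3 (λ k a c → k := k :* con (+ 1) :+ a :* con (+ 0) :+ c :* con (+ 0)) refl (β * σ) (σ - β) C₂) ⟩
              order ×# 1# * (β * σ * ι1 + (σ - β) * 0# + C₂ * 0#) ≈⟨ *-congˡ (T²-e₀ 0) ⟨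
              order ×# 1# * T^ 2 (e 0) 0                       ≈⟨ traces 2 ⟨
              ∑[ z < order ] power A 2 z z                     ≈⟨ proj₂ (proj₂ traces≈P) ⟩
              P 2                                              ≈⟨ +-cong (+-cong (+-cong (*-cong M₀≈1 (square _)) (*-congˡ (square _))) (*-congˡ (square _))) (*-cong M₃≈M₂ (square _)) ⟩
              ι1 * (β * σ * (β * σ)) + M₁ * (σ * σ) + M₂ * (θ 2F * θ 2F) + M₂ * (θ 3F * θ 3F)
                ≈⟨ solve 6 (λ k σ M₁ M₂ x y → con (+ 1) :* (k :* k) :+ M₁ :* (σ :* σ) :+ M₂ :* (x :* x) :+ M₂ :* (y :* y) :=
                                             k :* k :+ M₁ :* (σ :* σ) :+ M₂ :* ((x :+ y) :* (x :+ y) :- (x :* y :+ x :* y))) refl (β * σ) σ M₁ M₂ (θ 2F) (θ 3F) ⟩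
              β * σ * (β * σ) + M₁ * (σ * σ) + M₂ * ((θ 2F + θ 3F) * (θ 2F + θ 3F) - (θ 2F * θ 3F + θ 2F * θ 3F))
                ≈⟨ +-congˡ (*-congˡ (+-cong (*-cong sum≈τ sum≈τ) (-‿cong (+-cong product≈π product≈π)))) ⟩
              β * σ * (β * σ) + M₁ * (σ * σ) + M₂ * (τ * τ - (π + π)) ∎)
          }
          where
          square : ∀ u → u * (u * 1#) ≈ u * u
          square u = *-congˡ (*-identityʳ u)

    -- What the eigenvalue a₃ forces

    module SecondEigenvalue
      (a₃-eigenvalue : IsEigenvalue A (fromℤ a[ 3F ]))
      {b : ℤ} (b≡ : shillaParameter Γ ≡ b) (2≤b : + 2 ℤ.≤ b)
      where

      k s : ℤ
      k = + b[ 0F ]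
      s = a[ 3F ]

      a₁≡ : a[ 1F ] ≡ k ℤ.- + b[ 1F ] ℤ.- 1ℤ
      a₁≡ = ≡.cong (λ i → k ℤ.- + b[ 1F ] ℤ.- + i) c₁≡1

      s≡ : s ≡ k ℤ.- + c[ 3F ]
      s≡ = ≡.trans (≡.cong (λ i → k ℤ.- + i ℤ.- + c[ 3F ]) b₃≡0) (identity k (+ c[ 3F ]))
        where
        identity : ∀ k c → k ℤ.- 0ℤ ℤ.- c ≡ k ℤ.- c
        identity = solve-∀

      private
        K B₁ B₂ C₂ C₃ S a₁ : Carrier
        K  = b[ 0F ] ×# 1#
        B₁ = b[ 1F ] ×# 1#
        B₂ = b[ 2F ] ×# 1#
        C₂ = c[ 2F ] ×# 1#
        C₃ = c[ 3F ] ×# 1#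
        S  = fromℤ s
        a₁ = K - B₁ - 1 ×# 1#

      a₃≈ : K - C₃ ≈ S
      a₃≈ = sym (trans (reflexive (≡.cong fromℤ s≡)) (fromℤ-minus k (+ c[ 3F ])))

      open Radial {k = K} refl {b₁ = B₁} refl {c₂ = C₂} refl {b₂ = B₂} refl {c₃ = C₃} refl {a₁ = a₁} refl {a₂ = K - B₂ - C₂} refl a₃≈

      private
        v      = proj₁ a₃-eigenvalue
        y₀     = proj₁ (proj₂ (proj₂ a₃-eigenvalue))
        v#0    = proj₂ (proj₂ (proj₂ a₃-eigenvalue))
      open Eigenvector (proj₁ (proj₂ a₃-eigenvalue)) y₀

      -- For this eigenvalue the terms a₃ g₃ on the two sides of `μg₃` cancel, leaving b₂ g₂ = 0.
      g₂≈0 : g 2 ≈ 0#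
      g₂≈0 = #0-zero-product (positive#0 0<b₂) (begin
        B₂ * g 2                        ≈⟨ solve 3 (λ b g s → b :* g := b :* g :+ s :- s) refl B₂ (g 2) (S * g 3) ⟩
        B₂ * g 2 + S * g 3 - S * g 3    ≈⟨ x≈y⇒x-y≈0 (sym μg₃) ⟩
        0#                              ∎)

      -- Once `g 2` vanishes, the recurrence at distance one is a multiple of the entry `v y₀`,
      -- which is apart from zero.
      s²≡k+a₁s : s ℤ.* s ≡ k ℤ.+ (k ℤ.- + b[ 1F ] ℤ.- 1ℤ) ℤ.* s
      s²≡k+a₁s = ↦-injective (int s ⊗ int s) (int k ⊕ (int k ⊖ int (+ b[ 1F ]) ⊖ int 1ℤ) ⊗ int s)
        (x-y≈0⇒x≈y (#0-zero-product v#0 (begin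
          v y₀ * (S * S - (K + a₁ * S))
            ≈⟨ solve 5 (λ v s k a c → v :* (s :* s :- (k :+ a :* s)) := s :* (s :* v) :- (k :* v :+ a :* (s :* v) :+ c :* con (+ 0))) refl (v y₀) S K a₁ C₂ ⟩
          S * (S * v y₀) - (K * v y₀ + a₁ * (S * v y₀) + C₂ * 0#)
            ≈⟨ +-cong (*-congˡ (sym g₁)) (-‿cong (+-cong (+-congˡ (*-congˡ (sym g₁))) (*-congˡ (sym g₂≈0)))) ⟩
          S * g 1 - (K * v y₀ + a₁ * g 1 + C₂ * g 2)
            ≈⟨ x≈y⇒x-y≈0 μg₁ ⟩
          0# ∎)))

      b≡s-a₁ : b ≡ s ℤ.- (k ℤ.- + b[ 1F ] ℤ.- 1ℤ)
      b≡s-a₁ = ≡.trans (≡.sym b≡) (≡.cong (λ i → s ℤ.- i) a₁≡)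

      k≡bs : k ≡ b ℤ.* s
      k≡bs = ≡.sym (≡.trans (≡.cong (ℤ._* s) b≡s-a₁) (ℤ.i-j≡0⇒i≡j _ _
        (≡.trans (identity s _ k) (ℤ.i≡j⇒i-j≡0 s²≡k+a₁s))))
        where
        identity : ∀ s a k → (s ℤ.- a) ℤ.* s ℤ.- k ≡ s ℤ.* s ℤ.- (k ℤ.+ a ℤ.* s)
        identity = solve-∀

      b₁≡ : + b[ 1F ] ≡ (b ℤ.- 1ℤ) ℤ.* (s ℤ.+ 1ℤ)
      b₁≡ = ≡.trans (identity s k (+ b[ 1F ]))
        (≡.trans (≡.cong₂ (λ k b → k ℤ.- 1ℤ ℤ.- s ℤ.+ b) k≡bs (≡.sym b≡s-a₁)) (factor b s))
        where
        identity : ∀ s k b₁ → b₁ ≡ k ℤ.- 1ℤ ℤ.- s ℤ.+ (s ℤ.- (k ℤ.- b₁ ℤ.- 1ℤ))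
        identity = solve-∀
        factor : ∀ b s → b ℤ.* s ℤ.- 1ℤ ℤ.- s ℤ.+ b ≡ (b ℤ.- 1ℤ) ℤ.* (s ℤ.+ 1ℤ)
        factor = solve-∀

      c₃≡ : + c[ 3F ] ≡ (b ℤ.- 1ℤ) ℤ.* s
      c₃≡ = ≡.trans (identity k (+ c[ 3F ])) (≡.trans (≡.cong₂ ℤ._-_ k≡bs (≡.sym s≡)) (factor b s))
        where
        identity : ∀ k c → c ≡ k ℤ.- (k ℤ.- c)
        identity = solve-∀
        factor : ∀ b s → b ℤ.* s ℤ.- s ≡ (b ℤ.- 1ℤ) ℤ.* s
        factor = solve-∀

      0<b-1 : 0ℤ ℤ.< b ℤ.- 1ℤ
      0<b-1 = i<j⇒0<j-i (ℤ.<-≤-trans (+<+ (s≤s (s≤s z≤n))) 2≤b)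

      0<[b-1]s : 0ℤ ℤ.< (b ℤ.- 1ℤ) ℤ.* s
      0<[b-1]s = ≡.subst (0ℤ ℤ.<_) c₃≡ (+<+ 0<c₃)

      0<s : 0ℤ ℤ.< s
      0<s = positive-factor 0<b-1 0<[b-1]s

      -- The gap b s - s is c₃. Strictness is what separates k from θ₁ in the spectrum.
      s<k : s ℤ.< b ℤ.* s
      s<k = ℤ.≰⇒> λ bs≤s → positive+nonneg≢0 0<[b-1]s (ℤ.i≤j⇒0≤j-i bs≤s) (identity b s)
        where
        identity : ∀ b s → (b ℤ.- 1ℤ) ℤ.* s ℤ.+ (s ℤ.- b ℤ.* s) ≡ 0ℤ
        identity = solve-∀

-- Integer consequences of the multiplicity equations

open import Data.Integer.Base using (-_; _+_; _-_; _*_; _<_; _≤_)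

module Arithmetic
  (b s b₂ c₂ n m₁ m₂ : ℤ)
  (2≤b : + 2 ≤ b) (0<s : 0ℤ < s) (0<b₂ : 0ℤ < b₂) (0<c₂ : 0ℤ < c₂) (0≤m₁ : 0ℤ ≤ m₁) (0≤m₂ : 0ℤ ≤ m₂)
  (n-array : n * (c₂ * ((b - 1ℤ) * s)) ≡ (b * s - s) * (b * s * (b * s) - (s - b - (b₂ + c₂)) * (b * s) + (b * b₂ + c₂ - b * s)))
  (trace₀  : n ≡ 1ℤ + m₁ + (m₂ + m₂))
  (trace₁  : 0ℤ ≡ b * s + m₁ * s + m₂ * (s - b - (b₂ + c₂)))
  (trace₂  : n * (b * s) ≡ b * s * (b * s) + m₁ * (s * s) +
               m₂ * ((s - b - (b₂ + c₂)) * (s - b - (b₂ + c₂)) - ((b * b₂ + c₂ - b * s) + (b * b₂ + c₂ - b * s))))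
  (0≤s-b : 0ℤ ≤ s - b)
  (p³₃₃-nonneg : 0ℤ ≤ b₂ * (s + b) - c₂ * (s + 1ℤ))
  where

  0<b : 0ℤ < b
  0<b = ℤ.<-≤-trans (+<+ (s≤s z≤n)) 2≤b

  0<b-1 : 0ℤ < b - 1ℤ
  0<b-1 = i<j⇒0<j-i (ℤ.<-≤-trans (+<+ (s≤s (s≤s z≤n))) 2≤b)

  0≤b  = ℤ.<⇒≤ 0<b
  0≤s  = ℤ.<⇒≤ 0<s
  0≤b₂ = ℤ.<⇒≤ 0<b₂
  0≤c₂ = ℤ.<⇒≤ 0<c₂
  0≤b-1 = ℤ.<⇒≤ 0<b-1

  lower : s - b < b₂ + c₂
  lower = ℤ.≰⇒> λ e≤s-b → positive+nonneg≢0 (0<i*j 0<b 0<s)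
    (0≤i+j (0≤i*j 0≤m₁ 0≤s) (0≤i*j 0≤m₂ (ℤ.i≤j⇒0≤j-i e≤s-b)))
    (≡.trans (≡.sym (ℤ.+-assoc (b * s) (m₁ * s) _)) (≡.sym trace₁))

  -- Uses that θ₂ and θ₃ are real: (θ₂ - θ₃)² = (t + 2 b)² + 4 (b - 1) c₂, where
  -- t = s - b - (b₂ + c₂) = θ₂ + θ₃.
  upper : b₂ + c₂ < s + b
  upper = ℤ.≰⇒> λ s+b≤e → let 0≤h = ℤ.i≤j⇒0≤j-i s+b≤e in
    positive+nonneg≢0
      (0<i*j (+<+ (s≤s (z≤n {1}))) (0<i*j (0<i*j 0<b 0<b-1) (0<i*j 0<s (0≤i⇒0<i+1 0≤s))))
      (0≤i+j (0≤i+j (0≤i+j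
        (0≤i*j (0≤i*j 0≤h 0≤s) (0≤i+j 0≤b 0≤m₁))
        (0≤i*j 0≤m₂ (0≤i*j 0≤h 0≤h)))
        (0≤i*j (0≤i*j (+≤+ (z≤n {4})) 0≤m₂) (0≤i*j 0≤b-1 0≤c₂)))
        (0≤i*j (0≤i*j (+≤+ (z≤n {2})) 0≤s) (0≤i*j 0≤m₂ 0≤h)))
      (≡.trans (identity b s b₂ c₂ n m₁ m₂)
        (≡.cong₂ _+_ (≡.cong₂ _+_
          (≡.cong (+ 2 *_) (ℤ.i≡j⇒i-j≡0 (≡.sym trace₂)))
          (≡.trans (≡.cong (+ 2 * b * s *_) (ℤ.i≡j⇒i-j≡0 trace₀)) (ℤ.*-zeroʳ (+ 2 * b * s))))
          (≡.trans (≡.cong ((b₂ + c₂ + b - s - + 2 * s) *_) (≡.sym trace₁)) (ℤ.*-zeroʳ (b₂ + c₂ + b - s - + 2 * s)))))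
    where
    -- Let h = e - (s + b) with e = b₂ + c₂. Besides twice `trace₂`, a multiple of `trace₀` removes
    -- n. The multiplier - t - 2 s of `trace₁` turns 2 m₂ (t² - 2 q) into m₂ (θ₂ - θ₃)², up to the
    -- term 2 s m₂ h, and reduces the terms in m₁ to m₁ s h.
    identity : ∀ b s b₂ c₂ n m₁ m₂ →
      + 2 * (b * (b - 1ℤ) * (s * (s + 1ℤ))) +
        ((b₂ + c₂ - (s + b)) * s * (b + m₁) + m₂ * ((b₂ + c₂ - (s + b)) * (b₂ + c₂ - (s + b))) +
         + 4 * m₂ * ((b - 1ℤ) * c₂) + + 2 * s * (m₂ * (b₂ + c₂ - (s + b)))) ≡
      + 2 * (b * s * (b * s) + m₁ * (s * s) +
               m₂ * ((s - b - (b₂ + c₂)) * (s - b - (b₂ + c₂)) - ((b * b₂ + c₂ - b * s) + (b * b₂ + c₂ - b * s))) - n * (b * s)) +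
      + 2 * b * s * (n - (1ℤ + m₁ + (m₂ + m₂))) +
      (b₂ + c₂ + b - s - + 2 * s) * (b * s + m₁ * s + m₂ * (s - b - (b₂ + c₂)))
    identity = solve-∀

  -- Otherwise `upper` gives 2 b₂ < s, and then c₂ (s + 1) ≥ (b₂ + b) (s + 1) > b₂ (s + b), against
  -- `p³₃₃-nonneg`.
  c₂-bound : c₂ < b₂ + b
  c₂-bound = ℤ.≰⇒> λ b₂+b≤c₂ → let 0≤g = ℤ.i≤j⇒0≤j-i b₂+b≤c₂ in
    positive+nonneg≢0 (0<i*j 0<b₂ (0≤i⇒0<i+1 0≤b))
      (0≤i+j (0≤i+j
        (0≤i*j 0≤b (ℤ.<⇒≤ (0≤i⇒0<i+1 (0≤i+j 0≤g (ℤ.<⇒≤ (i<j⇒0<j-i upper))))))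
        (0≤i*j 0≤g (ℤ.<⇒≤ (0≤i⇒0<i+1 0≤s))))
        p³₃₃-nonneg)
      (identity b s b₂ c₂)
    where
    identity : ∀ b s b₂ c₂ →
      b₂ * (b + 1ℤ) + (b * (c₂ - (b₂ + b) + (s + b - (b₂ + c₂)) + 1ℤ) + (c₂ - (b₂ + b)) * (s + 1ℤ) + (b₂ * (s + b) - c₂ * (s + 1ℤ))) ≡ 0ℤ
    identity = solve-∀

  n-equation : n * c₂ - (b * s * (b * s) - (s - b - (b₂ + c₂)) * (b * s) + (b * b₂ + c₂ - b * s)) ≡ 0ℤ
  n-equation = positive-cancel-0 ((b - 1ℤ) * s) (0<i*j 0<b-1 0<s)
    (≡.trans (identity b s n c₂ _) (ℤ.i≡j⇒i-j≡0 n-array))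
    where
    identity : ∀ b s n c₂ r → (b - 1ℤ) * s * (n * c₂ - r) ≡ n * (c₂ * ((b - 1ℤ) * s)) - (b * s - s) * r
    identity = solve-∀

  -- Three linear equations in the two unknowns m₁ and m₂: the determinant of the augmented system
  -- must vanish. The multipliers in `identity` are its cofactors up to sign, and a factor `s` is
  -- cancelled.
  multiplicity-free : ∀ t q →
    0ℤ ≡ b * s + m₁ * s + m₂ * t →
    n * (b * s) ≡ b * s * (b * s) + m₁ * (s * s) + m₂ * (t * t - (q + q)) →
    (n + b - 1ℤ) * (t * t - (q + q) - s * t) - b * (n - b * s + s) * (+ 2 * s - t) ≡ 0ℤ
  multiplicity-free t q eq₁ eq₂ = positive-cancel-0 s 0<s
    (≡.trans (identity b s n m₁ m₂ t (t * t - (q + q)))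
      (≡.cong₂ _+_ (≡.cong₂ _+_
        (≡.trans (≡.cong ((+ 2 * s - t) *_) (ℤ.i≡j⇒i-j≡0 (≡.sym eq₂))) (ℤ.*-zeroʳ (+ 2 * s - t)))
        (≡.trans (≡.cong (((t * t - (q + q)) - s * t) * s *_) (ℤ.i≡j⇒i-j≡0 trace₀)) (ℤ.*-zeroʳ (((t * t - (q + q)) - s * t) * s))))
        (≡.trans (≡.cong ((t * t - (q + q) - + 2 * s * s) *_) (≡.sym eq₁)) (ℤ.*-zeroʳ (t * t - (q + q) - + 2 * s * s)))))
    where
    identity : ∀ b s n m₁ m₂ t y →
      s * ((n + b - 1ℤ) * (y - s * t) - b * (n - b * s + s) * (+ 2 * s - t)) ≡
      (+ 2 * s - t) * (b * s * (b * s) + m₁ * (s * s) + m₂ * y - n * (b * s)) +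
      (y - s * t) * s * (n - (1ℤ + m₁ + (m₂ + m₂))) +
      (y - + 2 * s * s) * (b * s + m₁ * s + m₂ * t)
    identity = solve-∀

  -- `multiplicity-free` is linear in n with the leading coefficient `coefficient`; combining it
  -- with `n-equation` eliminates n, and the positive factor b (s + 1) splits off.
  star : (+ 2 * b * b₂ + + 2 * c₂ - (b₂ + c₂) * (b₂ + c₂ + b - s)) * (b₂ + c₂ + (b - 1ℤ) * s) - (b - 1ℤ) * c₂ * (s + (b₂ + c₂) + b) ≡ 0ℤ
  star = positive-cancel-0 (b * (s + 1ℤ)) (0<i*j 0<b (0≤i⇒0<i+1 0≤s))
    (≡.trans (identity b s b₂ c₂ n) (≡.cong₂ _-_
      (≡.trans (≡.cong (coefficient b s b₂ c₂ *_) n-equation) (ℤ.*-zeroʳ (coefficient b s b₂ c₂)))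
      (≡.trans (≡.cong (c₂ *_) (multiplicity-free (s - b - (b₂ + c₂)) (b * b₂ + c₂ - b * s) trace₁ trace₂)) (ℤ.*-zeroʳ c₂))))
    where
    coefficient : ℤ → ℤ → ℤ → ℤ → ℤ
    coefficient b s b₂ c₂ =
      (s - b - (b₂ + c₂)) * (s - b - (b₂ + c₂)) - ((b * b₂ + c₂ - b * s) + (b * b₂ + c₂ - b * s)) - s * (s - b - (b₂ + c₂)) -
      b * (+ 2 * s - (s - b - (b₂ + c₂)))

    identity : ∀ b s b₂ c₂ n →
      b * (s + 1ℤ) * ((+ 2 * b * b₂ + + 2 * c₂ - (b₂ + c₂) * (b₂ + c₂ + b - s)) * (b₂ + c₂ + (b - 1ℤ) * s) - (b - 1ℤ) * c₂ * (s + (b₂ + c₂) + b)) ≡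
      ((s - b - (b₂ + c₂)) * (s - b - (b₂ + c₂)) - ((b * b₂ + c₂ - b * s) + (b * b₂ + c₂ - b * s)) - s * (s - b - (b₂ + c₂)) -
        b * (+ 2 * s - (s - b - (b₂ + c₂)))) *
        (n * c₂ - (b * s * (b * s) - (s - b - (b₂ + c₂)) * (b * s) + (b * b₂ + c₂ - b * s))) -
      c₂ * ((n + b - 1ℤ) * ((s - b - (b₂ + c₂)) * (s - b - (b₂ + c₂)) - ((b * b₂ + c₂ - b * s) + (b * b₂ + c₂ - b * s)) - s * (s - b - (b₂ + c₂))) -
            b * (n - b * s + s) * (+ 2 * s - (s - b - (b₂ + c₂))))
    identity = solve-∀

  -- With δ = c₂ - b₂ and w = 2 s - b (b - 1) - 2 δ (b² - 1) the equation reads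
  -- s w = δ b (b - 1); for integral δ ≠ 0 this is impossible by size.
  e≡s⇒2s≡b[b-1] : b₂ + c₂ ≡ s → + 2 * s ≡ b * (b - 1ℤ)
  e≡s⇒2s≡b[b-1] e≡s = by-sign (ℤ.<-cmp 0ℤ δ)
    where
    δ w : ℤ
    δ = c₂ - b₂
    w = + 2 * s - b * (b - 1ℤ) - + 2 * δ * (b * b - 1ℤ)

    -- Doubling `star` clears the denominators of b₂ = (s - δ) / 2 and c₂ = (s + δ) / 2.
    sw : s * w ≡ δ * b * (b - 1ℤ)
    sw = ℤ.i-j≡0⇒i≡j _ _ (≡.trans (≡.cong (λ s → s * (+ 2 * s - b * (b - 1ℤ) - + 2 * δ * (b * b - 1ℤ)) - δ * b * (b - 1ℤ)) (≡.sym e≡s))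
      (≡.trans (identity b b₂ c₂) (≡.cong (+ 2 *_) (≡.trans (≡.cong (λ s → (+ 2 * b * b₂ + + 2 * c₂ - (b₂ + c₂) * (b₂ + c₂ + b - s)) * (b₂ + c₂ + (b - 1ℤ) * s) - (b - 1ℤ) * c₂ * (s + (b₂ + c₂) + b)) e≡s) star))))
      where
      identity : ∀ b b₂ c₂ → let s = b₂ + c₂ in
        s * (+ 2 * s - b * (b - 1ℤ) - + 2 * (c₂ - b₂) * (b * b - 1ℤ)) - (c₂ - b₂) * b * (b - 1ℤ) ≡
        + 2 * ((+ 2 * b * b₂ + + 2 * c₂ - (b₂ + c₂) * (b₂ + c₂ + b - s)) * (b₂ + c₂ + (b - 1ℤ) * s) - (b - 1ℤ) * c₂ * (s + (b₂ + c₂) + b))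
      identity = solve-∀

    by-sign : _ → + 2 * s ≡ b * (b - 1ℤ)
    -- Here w is positive, hence at least 1, while 2 s = w + b (b - 1) + 2 δ (b² - 1) already
    -- exceeds 2 δ b (b - 1); so s w is too large.
    by-sign (tri< 0<δ _ _) = contradiction (≡.trans (identity b s δ) (≡.trans (≡.cong (λ x → + 2 * x - + 2 * (δ * b * (b - 1ℤ))) sw) (ℤ.+-inverseʳ (+ 2 * (δ * b * (b - 1ℤ))))))
      (positive+nonneg≢0 (0<i*j (0<i*j (+<+ (s≤s (z≤n {1}))) 0<δ) 0<b-1)
        (0≤i+j (0≤i+j (0≤i*j (0≤i*j 0≤w 0≤b) 0≤b-1) (0≤i*j 0≤w 0≤w))
          (0≤i*j (0≤i*j (0≤i*j (+≤+ (z≤n {2})) (ℤ.<⇒≤ 0<δ)) 0≤b-1) (0≤i*j (0<i⇒0≤i-1 0<w) (ℤ.<⇒≤ (0≤i⇒0<i+1 0≤b))))))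
      where
      0<w : 0ℤ < w
      0<w = positive-factor 0<s (≡.subst (0ℤ <_) (≡.sym sw) (0<i*j (0<i*j 0<δ 0<b) 0<b-1))

      0≤w = ℤ.<⇒≤ 0<w

      identity : ∀ b s δ → let w = + 2 * s - b * (b - 1ℤ) - + 2 * δ * (b * b - 1ℤ) in
        + 2 * δ * (b - 1ℤ) + (w * b * (b - 1ℤ) + w * w + + 2 * δ * (b - 1ℤ) * ((w - 1ℤ) * (b + 1ℤ))) ≡
        + 2 * (s * w) - + 2 * (δ * b * (b - 1ℤ))
      identity = solve-∀
    by-sign (tri≈ _ 0≡δ _) = ℤ.i-j≡0⇒i≡j _ _ (≡.trans (identity b s δ) (≡.cong₂ _+_
      (positive-cancel-0 s 0<s (≡.trans sw (≡.cong (λ δ → δ * b * (b - 1ℤ)) (≡.sym 0≡δ))))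
      (≡.cong (λ δ → + 2 * δ * (b * b - 1ℤ)) (≡.sym 0≡δ))))
      where
      identity : ∀ b s δ → + 2 * s - b * (b - 1ℤ) ≡ + 2 * s - b * (b - 1ℤ) - + 2 * δ * (b * b - 1ℤ) + + 2 * δ * (b * b - 1ℤ)
      identity = solve-∀
    -- With w ≤ 0 and δ ≤ -1 the definition of w bounds 2 s by - (b - 1) (b + 2), which is negative.
    by-sign (tri> _ _ δ<0) = contradiction (identity b s δ)
      (positive+nonneg≢0 (0<i*j (+<+ (s≤s (z≤n {1}))) 0<s)
        (0≤i+j (0≤i+j 0≤-w (0≤i*j (0≤i*j (+≤+ (z≤n {2})) (0<i⇒0≤i-1 0<-δ)) (0≤i*j 0≤b-1 (ℤ.<⇒≤ (0≤i⇒0<i+1 0≤b)))))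
          (0≤i*j 0≤b-1 (0≤i+j 0≤b (+≤+ (z≤n {2}))))))
      where
      0<-δ : 0ℤ < - δ
      0<-δ = ℤ.neg-mono-< δ<0

      negate : ∀ s w → s * (- w) ≡ - (s * w)
      negate = solve-∀

      negate′ : ∀ b δ → - (δ * b * (b - 1ℤ)) ≡ - δ * b * (b - 1ℤ)
      negate′ = solve-∀

      0≤-w : 0ℤ ≤ - w
      0≤-w = ℤ.<⇒≤ (positive-factor 0<s (≡.subst (0ℤ <_) (≡.sym (≡.trans (negate s w) (≡.trans (≡.cong -_ sw) (negate′ b δ)))) (0<i*j (0<i*j 0<-δ 0<b) 0<b-1)))

      identity : ∀ b s δ → let w = + 2 * s - b * (b - 1ℤ) - + 2 * δ * (b * b - 1ℤ) in
        + 2 * s + (- w + + 2 * (- δ - 1ℤ) * ((b - 1ℤ) * (b + 1ℤ)) + (b - 1ℤ) * (b + + 2)) ≡ 0ℤ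
      identity = solve-∀

  -- Here w = s - e, and dividing `star` by c₂ gives `R≡0`, whose left side at w = 0 is 2 s - b (b -
  -- 1). For integral w that left side is positive if w ≥ 1, thanks to s ≥ b, and negative if w ≤
  -- -1.
  b₂≡c₂⇒2s≡b[b-1] : b₂ ≡ c₂ → + 2 * s ≡ b * (b - 1ℤ)
  b₂≡c₂⇒2s≡b[b-1] b₂≡c₂ = by-sign (ℤ.<-cmp 0ℤ w)
    where
    w : ℤ
    w = s - + 2 * c₂

    R≡0 : + 2 * (w + 1ℤ) * (b * s - w) - (b - 1ℤ) * (+ 2 * s - w + b) ≡ 0ℤ
    R≡0 = positive-cancel-0 c₂ 0<c₂ (≡.trans (identity b s c₂)
      (≡.trans (≡.cong (λ b₂ → (+ 2 * b * b₂ + + 2 * c₂ - (b₂ + c₂) * (b₂ + c₂ + b - s)) * (b₂ + c₂ + (b - 1ℤ) * s) - (b - 1ℤ) * c₂ * (s + (b₂ + c₂) + b)) (≡.sym b₂≡c₂)) star))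
      where
      identity : ∀ b s c₂ → let w = s - + 2 * c₂ ; b₂ = c₂ in
        c₂ * (+ 2 * (w + 1ℤ) * (b * s - w) - (b - 1ℤ) * (+ 2 * s - w + b)) ≡
        (+ 2 * b * b₂ + + 2 * c₂ - (b₂ + c₂) * (b₂ + c₂ + b - s)) * (b₂ + c₂ + (b - 1ℤ) * s) - (b - 1ℤ) * c₂ * (s + (b₂ + c₂) + b)
      identity = solve-∀

    by-sign : _ → + 2 * s ≡ b * (b - 1ℤ)
    by-sign (tri< 0<w _ _) = contradiction (≡.trans (identity b s c₂) R≡0)
      (positive+nonneg≢0 (0<i*j 0<b-1 0<s)
        (0≤i+j (0≤i*j 0≤b-1 (0≤i+j (0≤i+j (0≤i*j (0≤i*j (+≤+ (z≤n {2})) (0<i⇒0≤i-1 0<w)) 0≤s) 0≤s-b) (ℤ.<⇒≤ 0<w)))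
          (0≤i*j (0≤i*j (+≤+ (z≤n {4})) (ℤ.<⇒≤ (0≤i⇒0<i+1 (ℤ.<⇒≤ 0<w)))) 0≤c₂)))
      where
      identity : ∀ b s c₂ → let w = s - + 2 * c₂ in
        (b - 1ℤ) * s + ((b - 1ℤ) * (+ 2 * (w - 1ℤ) * s + (s - b) + w) + + 4 * (w + 1ℤ) * c₂) ≡
        + 2 * (w + 1ℤ) * (b * s - w) - (b - 1ℤ) * (+ 2 * s - w + b)
      identity = solve-∀
    by-sign (tri≈ _ 0≡w _) = ℤ.i-j≡0⇒i≡j _ _ (≡.trans (identity b s)
      (≡.trans (≡.cong (λ w → + 2 * (w + 1ℤ) * (b * s - w) - (b - 1ℤ) * (+ 2 * s - w + b)) 0≡w) R≡0))
      where
      identity : ∀ b s → + 2 * s - b * (b - 1ℤ) ≡ + 2 * (0ℤ + 1ℤ) * (b * s - 0ℤ) - (b - 1ℤ) * (+ 2 * s - 0ℤ + b)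
      identity = solve-∀
    by-sign (tri> _ _ w<0) = contradiction (≡.trans (identity b s c₂) (≡.cong -_ R≡0))
      (positive+nonneg≢0 (0<i*j 0<b-1 0<s)
        (0≤i+j (0≤i*j 0≤b-1 (0≤i+j (0≤i*j (+≤+ (z≤n {2})) 0≤c₂) 0≤b))
          (0≤i*j (0≤i*j (+≤+ (z≤n {2})) (0<i⇒0≤i-1 (ℤ.neg-mono-< w<0))) (0≤i+j (0≤i*j 0≤b-1 0≤s) (0≤i*j (+≤+ (z≤n {2})) 0≤c₂)))))
      where
      identity : ∀ b s c₂ → let w = s - + 2 * c₂ in
        (b - 1ℤ) * s + ((b - 1ℤ) * (+ 2 * c₂ + b) + + 2 * (- w - 1ℤ) * ((b - 1ℤ) * s + + 2 * c₂)) ≡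
        - (+ 2 * (w + 1ℤ) * (b * s - w) - (b - 1ℤ) * (+ 2 * s - w + b))
      identity = solve-∀

-- From the graph to the integer equations

theorem11 : ∀ {c ℓ₁ ℓ₂ ℓ₃} (ℝ : RealField c ℓ₁ ℓ₂ ℓ₃)
    (Γ : DistanceRegularGraph 3)
    (θ : Fin 4 → RealField.Carrier ℝ) (m : Fin 4 → ℕ) →
    Spectral.IsShilla ℝ Γ θ m →
    (b : ℤ) → shillaParameter Γ ≡ b → + 2 ≤ b →
    m 2F ≡ m 3F →
    let a₃ = DistanceRegularGraph.a[_] Γ 3F
        b₂ = + DistanceRegularGraph.b[_] Γ 2F
        c₂ = + DistanceRegularGraph.c[_] Γ 2F
    in ((a₃ - b < b₂ + c₂) × (b₂ + c₂ < a₃ + b))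
     × (c₂ < b₂ + b)
     × ((b₂ + c₂ ≡ a₃ ⊎ b₂ ≡ c₂) → a₃ / 1 ≡ (b * (b - 1ℤ)) / 2)
theorem11 ℝ Γ θ m isShilla b b≡ 2≤b m₂≡m₃ =
  (lower , upper) , c₂-bound , λ cases →
    halve ([ e≡s⇒2s≡b[b-1] , b₂≡c₂⇒2s≡b[b-1] ] cases)
  where
  open Spectral ℝ
  open IsShilla isShilla
  open IsSpectrum isSpectrum using (eigenvalue)
  open RealField ℝ using (fromℤ; *-congʳ) renaming (trans to ≈-trans)
  open DistanceRegularGraph Γ using (graph; order; a[_]; b[_]; c[_])
  open DistanceRegular₃ Γ using (0<b₂; 0<c₂)

  a₃-eigenvalue : IsEigenvalue (adjacencyMatrix graph) (fromℤ a[ 3F ])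
  a₃-eigenvalue with v , Av≈θv , nonzero ← eigenvalue 1F =
    v , (λ x → ≈-trans (Av≈θv x) (*-congʳ θ₁≈a₃)) , nonzero

  open SpectralTheory.SecondEigenvalue ℝ Γ a₃-eigenvalue b≡ 2≤b
  open SpectralTheory.Shilla ℝ Γ b s k≡bs b₁≡ c₃≡
    using (0≤s-b; p³₃₃-nonneg; multiplicityEquations; module MultiplicityEquations)
  open MultiplicityEquations (multiplicityEquations isSpectrum θ₁≈a₃ s<k m₂≡m₃)

  open Arithmetic b s (+ b[ 2F ]) (+ c[ 2F ]) (+ order) (+ m 1F) (+ m 2F)
    2≤b 0<s (+<+ 0<b₂) (+<+ 0<c₂) (+≤+ z≤n) (+≤+ z≤n) n-array trace₀ trace₁ trace₂ 0≤s-b p³₃₃-nonneg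

  halve : + 2 * s ≡ b * (b - 1ℤ) → s / 1 ≡ (b * (b - 1ℤ)) / 2
  -- `mkℚᵘ` stores the denominator minus one, so 0 and 1 stand for the denominators 1 and 2.
  halve 2s≡b[b-1] = ℚ.fromℚᵘ-cong {mkℚᵘ s 0} {mkℚᵘ (b * (b - 1ℤ)) 1} (*≡*
    (≡.trans (ℤ.*-comm s (+ 2)) (≡.trans 2s≡b[b-1] (≡.sym (ℤ.*-identityʳ (b * (b - 1ℤ)))))))
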